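{- Let $\mathcal{M}=(E,\mathcal{I})$ be a uniformly dense matroid of rank $r$ with $|E|=n$, whose elements arrive in an arbitrary (adversarially fixed) order $e_1,\dots,e_n$. Let $W=\{w_1>w_2>\dots>w_n\}$ be an arbitrary set of $n$ distinct non-negative weights, and let $\omega:E\to W$ be a uniformly random bijection. Let $\mathrm{ALG}(\omega)$ be the set returned by the following algorithm (which knows $\mathcal{M}$ in advance): (1) If $r<12$, run the optimal algorithm for the classical secretary problem on the $n$ weights (selecting at most one element) and return the resulting singleton (or empty set). (2) Otherwise, start with $\mathrm{ALG}=\emptyset$; observe without selecting the first half of the input $A=\{e_1,\dots,e_{n/2}\}$ and let $w^*$ be the $(\lfloor r/4\rfloor+1)$-st largest weight among the elements of $A$; then for each subsequently arriving element $e\in B=\{e_{n/2+1},\dots,e_n\}$, add $e$ to $\mathrm{ALG}$ if $\omega(e)>w^*$ and $\mathrm{ALG}\cup\{e\}$ is independent; finally return $\mathrm{ALG}$. Then $$\mathbb{E}_\omega\big[w(\mathrm{ALG}(\omega))\big]\ \ge\ \frac{1}{40}\sum_{i=1}^{r} w_i,$$ where $w_1>\dots>w_r$ are the $r$ largest weights in $W$ and $w(S)=\sum_{e\in S}\omega(e)$.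
   Context: A matroid $\mathcal{M}=(E,\mathcal{I})$ is uniformly dense if $\frac{|S|}{\mathrm{rank}(S)}\le \frac{|E|}{\mathrm{rank}(E)}$ for all nonempty $S\subseteq E$ of positive rank (in particular it has no loops). The algorithm is online: elements are revealed one by one together with their weights, and each must be irrevocably accepted or rejected upon arrival. The optimal classical secretary algorithm selects the maximum weight with probability at least $1/e$.
   Formalization: The weights in W are taken to be non-negative rational numbers instead of arbitrary non-negative real numbers. -}

module Defs where

open import Data.Nat as ℕ using (ℕ; zero; suc; _∸_; _≥_)
open import Data.Nat.Base using (_/_; _⊔_)
open import Data.Bool using (Bool; true; false; if_then_else_; _∧_; not)
open import Data.Fin using (Fin; toℕ; _≟_)
open import Data.Fin.Subset using (Subset; ⊥; ⊤; ∣_∣; _∪_; ⁅_⁆; _⊆_; _∈_; _∉_; outside; inside)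
open import Data.Fin.Subset.Properties using (_⊆?_)
open import Data.Vec using (Vec; []; _∷_; lookup)
open import Data.List as L using (List; []; _∷_; allFin; map; foldr; filter; length; take; drop; reverse; concatMap; _++_)
open import Data.Maybe using (Maybe; just; nothing)
open import Data.Product using (∃; _×_)
open import Data.Rational as ℚ using (ℚ; 0ℚ; _+_; _<_)
open import Data.Rational.Properties using (_<?_; ≤-decTotalOrder)
open import Data.List.Sort ≤-decTotalOrder using (sort)
open import Relation.Nullary.Decidable using (⌊_⌋)
open import Relation.Binary.PropositionalEquality using (_≡_)

-- Finite matroids on the ground set E = Fin n (elements indexed by
-- their arrival position), with a decidable (Bool-valued) independence
-- oracle.

record Matroid (n : ℕ) : Set where
  field
    indep      : Subset n → Bool
    indep-∅    : indep ⊥ ≡ true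
    indep-⊆    : ∀ {X Y} → X ⊆ Y → indep Y ≡ true → indep X ≡ true
    indep-exch : ∀ {X Y} → indep X ≡ true → indep Y ≡ true → ∣ X ∣ ℕ.< ∣ Y ∣ →
                 ∃ λ e → e ∈ Y × e ∉ X × indep (⁅ e ⁆ ∪ X) ≡ true

allSubsets : ∀ n → List (Subset n)
allSubsets zero    = [] ∷ []
allSubsets (suc n) = map (outside ∷_) (allSubsets n) ++ map (inside ∷_) (allSubsets n)

rank : ∀ {n} → Matroid n → Subset n → ℕ
rank {n} M S =
  foldr _⊔_ 0 (map ∣_∣ (filter (λ X → X ⊆? S)
                          (filter (λ X → Matroid.indep M X Data.Bool.≟ true) (allSubsets n))))
  where import Data.Bool

rk : ∀ {n} → Matroid n → ℕ
rk M = rank M ⊤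

UniformlyDense : ∀ {n} → Matroid n → Set
UniformlyDense {n} M = ∀ (S : Subset n) → 0 ℕ.< rank M S → ∣ S ∣ ℕ.* rk M ℕ.≤ n ℕ.* rank M S

-- Uniformly random bijections ω : E → W.  W = {w 0 > w 1 > ... }, and a
-- bijection is given by an injective π : Fin n → Fin n (ω e = w (π e)).

allVecs : ∀ n m → List (Vec (Fin n) m)
allVecs n zero    = [] ∷ []
allVecs n (suc m) = concatMap (λ i → map (i ∷_) (allVecs n m)) (allFin n)

allB : ∀ {A : Set} → (A → Bool) → List A → Bool
allB p = foldr (λ x b → p x ∧ b) true

injectiveB : ∀ {n} → Vec (Fin n) n → Bool
injectiveB {n} v = allB (λ i → allB (λ j →
  if ⌊ lookup v i ≟ lookup v j ⌋ then ⌊ i ≟ j ⌋ else true) (allFin n)) (allFin n)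

allPerms : ∀ n → List (Vec (Fin n) n)
allPerms n = filter (λ v → injectiveB v Data.Bool.≟ true) (allVecs n n)
  where import Data.Bool

sumℚ : List ℚ → ℚ
sumℚ = foldr _+_ 0ℚ

-- Classical secretary on a sequence of weights: observe the first k,
-- then accept the first element beating all of them (k = 0: accept the
-- first element).  Returns the weight of the selected element, 0 if none.

maxM : List ℚ → Maybe ℚ
maxM []       = nothing
maxM (x ∷ xs) with maxM xs
... | nothing = just x
... | just y  = just (if ⌊ x <? y ⌋ then y else x)

beats : Maybe ℚ → ℚ → Bool
beats nothing  x = true
beats (just t) x = ⌊ t <? x ⌋

firstBeating : Maybe ℚ → List ℚ → ℚ
firstBeating t []       = 0ℚ
firstBeating t (x ∷ xs) = if beats t x then x else firstBeating t xs

secretaryCutoff : ℕ → List ℚ → ℚ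
secretaryCutoff k xs = firstBeating (maxM (take k xs)) (drop k xs)

weightsInOrder : ∀ {n} → (Fin n → ℚ) → Vec (Fin n) n → List ℚ
weightsInOrder {n} w π = map (λ e → w (lookup π e)) (allFin n)

-- number of bijections for which the cutoff-k rule selects the maximum
-- weight (w 0 is the maximum since w is strictly decreasing)
successCount : ∀ {n} → (Fin n → ℚ) → Fin n → ℕ → ℕ
successCount {n} w top k =
  length (filter (λ π → secretaryCutoff k (weightsInOrder w π) ℚ.≟ w top) (allPerms n))

optCutoff : ∀ {n} → (Fin n → ℚ) → Fin n → ℕ
optCutoff {n} w top = go (L.upTo (suc n)) 0 0
  where
  go : List ℕ → ℕ → ℕ → ℕ
  go []       best bestCount = best
  go (k ∷ ks) best bestCount =
    if ⌊ bestCount ℕ.<? successCount w top k ⌋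
    then go ks k (successCount w top k)
    else go ks best bestCount

classicalSecretary : ∀ {n} → (Fin n → ℚ) → Vec (Fin n) n → ℚ
classicalSecretary {zero}  w π = 0ℚ
classicalSecretary {suc n} w π =
  secretaryCutoff (optCutoff w Fin.zero) (weightsInOrder w π)
  where import Data.Fin as Fin

-- (j+1)-st largest value of a list (0-based index j of the descending sort)
nthLargest : ℕ → List ℚ → Maybe ℚ
nthLargest j xs = L.head (drop j (reverse (sort xs)))

thresholdGreedy : ∀ {n} → Matroid n → (Fin n → ℚ) → Vec (Fin n) n → ℚ
thresholdGreedy {n} M w π = go (allFin n) ⊥ 0ℚ
  where
  h   = n / 2
  ω   : Fin n → ℚ
  ω e = w (lookup π e)
  wStar : Maybe ℚ
  wStar = nthLargest (rk M / 4) (take h (weightsInOrder w π))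
  go : List (Fin n) → Subset n → ℚ → ℚ
  go []       S acc = acc
  go (e ∷ es) S acc =
    if ⌊ h ℕ.≤? toℕ e ⌋ ∧ beats wStar (ω e) ∧ Matroid.indep M (⁅ e ⁆ ∪ S)
    then go es (⁅ e ⁆ ∪ S) (acc + ω e)
    else go es S acc

algValue : ∀ {n} → Matroid n → (Fin n → ℚ) → Vec (Fin n) n → ℚ
algValue M w π =
  if ⌊ rk M ℕ.<? 12 ⌋ then classicalSecretary w π else thresholdGreedy M w π

{-# OPTIONS --safe #-}

-- Every estimate comes from one symmetry: precomposing the random bijection with a transposition of two
-- arrival positions is a bijection of the probability space.
--
-- Rank r < 12.  It suffices to pick the maximum weight with probability at least 11/40.  With cutoff
-- k = ⌊n/2⌋ the maximum at position j ≥ k is picked as soon as the best of the first j elements lies among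
-- the first k, which has probability k/j; the tangent of k/j at j = 3k/2 bounds the sum over j from below.
--
-- Rank r ≥ 12.  Let q = ⌊r/4⌋ and let e ∈ B carry one of the q + 1 largest weights.  Then e passes the
-- threshold, and it is selected unless it is spanned by its rivals, the other elements of B that pass.
-- On average there are at most q + 1 rivals, and t rivals span at most (t + 1) n / r elements by density;
-- given the rivals, the position of e is uniform on the rest of B.  Hence e is selected with
-- probability at least 1 − 2(q + 2)/r, and 20 (q + 1)(r − 2(q + 2)) ≥ r².
module Submission where

open import Defs

-- What greedy holds when an element arrives depends on the whole run, and the run has no symmetry.
-- The rivals do: `rivals π i` is defined from the weight index `i`, not from the position carrying
-- it, and it contains all that greedy can hold when that position arrives. Moving weight `i` to
-- another position of `B` that is not a rival changes neither the sample nor the rivals. What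
-- remains is a count: on average at most (q + 2) n / r positions are spanned, out of |B| ≥ n / 2
-- positions, which is the origin of the factor 2 in 2(q + 2)/r. The chance 1/2 that a weight falls
-- into `B` and the share (q + 1)/r of the top q + 1 weights among the top r turn the target 1/40
-- into 20 (q + 1)(r - 2(q + 2)) ≥ r². For r ≤ 11 each of the top r weights is at most the maximum,
-- hence 11/40. The point 3k/2 is the middle of the range k ≤ j < 2k; the sum of k/j over it is
-- about k ln 2, and the tangent replaces the logarithm by a rational bound that still gives success
-- probability 1/3. All probabilities are integer counts over `allPerms n` with denominators
-- multiplied out; rationals enter only with the weights.

module Lemmas where

  open import Data.Bool as Bool using (Bool; true; false; if_then_else_; _∧_)
  open import Data.Fin using (Fin; toℕ; _≟_; fromℕ<; punchOut) renaming (zero to fzero; suc to fsuc)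
  import Data.Fin.Properties as Finₚ
  open import Data.Fin.Subset using (Subset; ⊥; ⊤; ∣_∣; _∪_; ⁅_⁆; _⊆_; _∉_; outside; inside) renaming (_∈_ to _∈ₛ_)
  open import Data.Fin.Subset.Properties as Sₚ using (_⊆?_; _∈?_)
  open import Data.Integer as ℤ using ()
  import Data.Integer.Properties as ℤₚ
  open import Data.List as L using (List; []; _∷_; allFin; applyUpTo; drop; filter; foldr; length; map; reverse; tabulate; take; upTo)
  import Data.List.Properties as Lₚ
  open import Data.List.Membership.Propositional using (_∈_)
  open import Data.List.Membership.Propositional.Properties using (∈-allFin; ∈-upTo⁺; ∈-map⁺; ∈-map⁻; ∈-filter⁺; ∈-filter⁻; ∈-concatMap⁺; ∈-++⁺ˡ; ∈-++⁺ʳ)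
  open import Data.List.Membership.Propositional.Properties.WithK using (unique∧set⇒bag)
  open import Data.List.Relation.Binary.BagAndSetEquality using (∼bag⇒↭)
  open import Data.List.Relation.Binary.Permutation.Propositional as Perm using (_↭_; ↭-trans; ↭-sym)
  open import Data.List.Relation.Binary.Permutation.Propositional.Properties using (↭-reverse; All-resp-↭)
  open import Data.List.Relation.Unary.All as All using ([]; _∷_)
  import Data.List.Relation.Unary.All.Properties as Allₚ
  open import Data.List.Relation.Unary.AllPairs as AllPairs using (AllPairs; []; _∷_)
  import Data.List.Relation.Unary.AllPairs.Properties as AllPairsₚ
  open import Data.List.Relation.Unary.Any as Any using (here; there)
  import Data.List.Relation.Unary.Sorted.TotalOrder.Properties as Sortedₚ
  open import Data.List.Relation.Unary.Unique.Propositional using (Unique)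
  import Data.List.Relation.Unary.Unique.Propositional.Properties as Uₚ
  open import Data.Maybe using (Maybe; just; nothing)
  open import Data.Nat as ℕ using (ℕ; zero; suc; _+_; _*_; _∸_; _⊔_; _≤_; _<_; z≤n; s≤s; _≤?_; _<?_; NonZero)
  import Data.Nat.Properties as ℕₚ
  open import Data.Nat.DivMod using (_/_; _%_; m≡m%n+[m/n]*n; m%n<n; m/n<m; /-monoˡ-≤; m≥n⇒m/n>0)
  open import Data.Nat.Tactic.RingSolver using (solve-∀)
  open import Data.Product using (∃; _×_; _,_; proj₁; proj₂)
  open import Data.Rational as ℚ using (ℚ; 0ℚ; 1ℚ)
  import Data.Rational.Properties as ℚₚ
  import Data.Rational.Solver as ℚ-Solver
  import Data.Rational.Unnormalised as ℚᵘ
  import Data.Rational.Unnormalised.Properties as ℚᵘₚ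
  open import Data.List.Sort ℚₚ.≤-decTotalOrder using (sort; sort-↭; sort-↗)
  open import Data.Sum using (_⊎_; inj₁; inj₂)
  open import Data.Vec as V using (Vec; lookup)
  import Data.Vec.Properties as Vₚ
  open import Function using (_∘_; mk⇔)
  open import Relation.Binary using (DecTotalOrder; tri<; tri≈; tri>)
  open import Relation.Binary.PropositionalEquality using (_≡_; _≢_; refl; sym; trans; cong; cong₂; subst; module ≡-Reasoning)
  open import Relation.Nullary using (¬_; Dec; yes; no; does; contradiction)
  open import Relation.Nullary.Decidable using (⌊_⌋; _×-dec_; _⊎-dec_; _→-dec_; ¬?; decidable-stable)

  private variable
    n : ℕ
    A B P Q : Set

  -- Sums over lists and over all bijections

  ∑ : List A → (A → ℕ) → ℕ
  ∑ []       f = 0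
  ∑ (x ∷ xs) f = f x + ∑ xs f

  𝟙 : Dec P → ℕ
  𝟙 d = if does d then 1 else 0

  𝟙-mono : (p : Dec P) (q : Dec Q) → (P → Q) → 𝟙 p ≤ 𝟙 q
  𝟙-mono (yes p) (yes q) f = ℕₚ.≤-refl
  𝟙-mono (yes p) (no ¬q) f = contradiction (f p) ¬q
  𝟙-mono (no _)  q       f = z≤n

  𝟙-true : (p : Dec P) → P → 𝟙 p ≡ 1
  𝟙-true (yes _) _ = refl
  𝟙-true (no ¬p) p = contradiction p ¬p

  𝟙-false : (p : Dec P) → ¬ P → 𝟙 p ≡ 0
  𝟙-false (yes p) ¬p = contradiction p ¬p
  𝟙-false (no _)  _  = refl

  𝟙≤1 : (p : Dec P) → 𝟙 p ≤ 1
  𝟙≤1 (yes _) = ℕₚ.≤-refl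
  𝟙≤1 (no _)  = z≤n

  𝟙*-mono : (p : Dec P) {m n : ℕ} → (P → m ≤ n) → 𝟙 p * m ≤ 𝟙 p * n
  𝟙*-mono (yes p) f = ℕₚ.*-monoʳ-≤ 1 (f p)
  𝟙*-mono (no _)  f = z≤n

  ∑-mono : ∀ (xs : List A) {f g : A → ℕ} → (∀ x → x ∈ xs → f x ≤ g x) → ∑ xs f ≤ ∑ xs g
  ∑-mono []       h = z≤n
  ∑-mono (x ∷ xs) h = ℕₚ.+-mono-≤ (h x (here refl)) (∑-mono xs (λ y y∈ → h y (there y∈)))

  ∑-cong : ∀ (xs : List A) {f g : A → ℕ} → (∀ x → f x ≡ g x) → ∑ xs f ≡ ∑ xs g
  ∑-cong []       h = refl
  ∑-cong (x ∷ xs) h = cong₂ _+_ (h x) (∑-cong xs h)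

  +-interchange : ∀ a b c d → (a + b) + (c + d) ≡ (a + c) + (b + d)
  +-interchange = solve-∀

  ∑-+ : ∀ (xs : List A) (f g : A → ℕ) → ∑ xs (λ x → f x + g x) ≡ ∑ xs f + ∑ xs g
  ∑-+ []       f g = refl
  ∑-+ (x ∷ xs) f g = trans (cong (f x + g x +_) (∑-+ xs f g)) (+-interchange (f x) (g x) _ _)

  ∑-*ˡ : ∀ (xs : List A) k (f : A → ℕ) → ∑ xs (λ x → k * f x) ≡ k * ∑ xs f
  ∑-*ˡ []       k f = sym (ℕₚ.*-zeroʳ k)
  ∑-*ˡ (x ∷ xs) k f = trans (cong (k * f x +_) (∑-*ˡ xs k f)) (sym (ℕₚ.*-distribˡ-+ k (f x) _))

  ∑-*ʳ : ∀ (xs : List A) k (f : A → ℕ) → ∑ xs (λ x → f x * k) ≡ ∑ xs f * k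
  ∑-*ʳ xs k f = trans (∑-cong xs (λ x → ℕₚ.*-comm (f x) k)) (trans (∑-*ˡ xs k f) (ℕₚ.*-comm k _))

  ∑-zero : ∀ (xs : List A) → ∑ xs (λ _ → 0) ≡ 0
  ∑-zero []       = refl
  ∑-zero (x ∷ xs) = ∑-zero xs

  ∑-one : ∀ (xs : List A) → ∑ xs (λ _ → 1) ≡ length xs
  ∑-one []       = refl
  ∑-one (x ∷ xs) = cong suc (∑-one xs)

  ∑-swap : ∀ (xs : List A) (ys : List B) (f : A → B → ℕ) →
           ∑ xs (λ x → ∑ ys (f x)) ≡ ∑ ys (λ y → ∑ xs (λ x → f x y))
  ∑-swap []       ys f = sym (∑-zero ys)
  ∑-swap (x ∷ xs) ys f = trans (cong (∑ ys (f x) +_) (∑-swap xs ys f)) (sym (∑-+ ys (f x) _))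

  ∑-map : ∀ (g : A → B) (xs : List A) (f : B → ℕ) → ∑ (map g xs) f ≡ ∑ xs (f ∘ g)
  ∑-map g []       f = refl
  ∑-map g (x ∷ xs) f = cong (f (g x) +_) (∑-map g xs f)

  ∑-↭ : ∀ {xs ys : List A} (f : A → ℕ) → xs ↭ ys → ∑ xs f ≡ ∑ ys f
  ∑-↭ f Perm.refl         = refl
  ∑-↭ f (Perm.prep x p)   = cong (f x +_) (∑-↭ f p)
  ∑-↭ f (Perm.trans p q)  = trans (∑-↭ f p) (∑-↭ f q)
  ∑-↭ f (Perm.swap {xs} {ys} x y p) = begin
    f x + (f y + ∑ xs f) ≡⟨ ℕₚ.+-assoc (f x) _ _ ⟨
    f x + f y + ∑ xs f   ≡⟨ cong₂ _+_ (ℕₚ.+-comm (f x) (f y)) (∑-↭ f p) ⟩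
    f y + f x + ∑ ys f   ≡⟨ ℕₚ.+-assoc (f y) _ _ ⟩
    f y + (f x + ∑ ys f) ∎
    where open ≡-Reasoning

  ∈⇒≤∑ : ∀ {xs : List A} {x} (f : A → ℕ) → x ∈ xs → f x ≤ ∑ xs f
  ∈⇒≤∑ f (here refl) = ℕₚ.m≤m+n _ _
  ∈⇒≤∑ f (there x∈)  = ℕₚ.≤-trans (∈⇒≤∑ f x∈) (ℕₚ.m≤n+m _ _)

  ∑-𝟙≤1 : ∀ {xs : List A} {P : A → Set} (P? : ∀ x → Dec (P x)) → Unique xs →
          (∀ x y → P x → P y → x ≡ y) → ∑ xs (λ x → 𝟙 (P? x)) ≤ 1
  ∑-𝟙≤1 {xs = []}     P? u same = z≤n
  ∑-𝟙≤1 {xs = x ∷ xs} P? (x≢ ∷ u) same with P? x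
  ... | no _  = ∑-𝟙≤1 P? u same
  ... | yes p = s≤s (ℕₚ.≤-trans (∑-mono xs zero-tail) (ℕₚ.≤-reflexive (∑-zero xs)))
    where
    zero-tail : ∀ y → y ∈ xs → 𝟙 (P? y) ≤ 0
    zero-tail y y∈ = ℕₚ.≤-reflexive (𝟙-false (P? y) (λ py → All.lookup x≢ y∈ (same x y p py)))

  -- Both `map τ xs` and `xs` are duplicate-free with the same members, so each is a permutation of
  -- the other.
  ∑-involution : ∀ {xs : List A} (τ : A → A) → Unique xs → (∀ x → τ (τ x) ≡ x) →
                 (∀ {x} → x ∈ xs → τ x ∈ xs) → (f : A → ℕ) → ∑ xs (f ∘ τ) ≡ ∑ xs f
  ∑-involution {xs = xs} τ u inv closed f = trans (sym (∑-map τ xs f)) (∑-↭ f τxs↭xs)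
    where
    inj : ∀ {x y} → τ x ≡ τ y → x ≡ y
    inj {x} {y} eq = trans (sym (inv x)) (trans (cong τ eq) (inv y))
    back : ∀ {x} → x ∈ map τ xs → x ∈ xs
    back x∈ with ∈-map⁻ τ x∈
    ... | y , y∈ , refl = closed y∈
    τxs↭xs : map τ xs ↭ xs
    τxs↭xs = ∼bag⇒↭ (unique∧set⇒bag (Uₚ.map⁺ inj u) u
      (λ {x} → mk⇔ back (λ x∈ → subst (_∈ map τ xs) (inv x) (∈-map⁺ τ (closed x∈)))))

  length-filter : ∀ {P : A → Set} (P? : ∀ x → Dec (P x)) xs → length (filter P? xs) ≡ ∑ xs (λ x → 𝟙 (P? x))
  length-filter P? []       = refl
  length-filter P? (x ∷ xs) with P? x
  ... | yes _ = cong suc (length-filter P? xs)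
  ... | no _  = length-filter P? xs

  ∑-allFin-suc : ∀ n (f : Fin (suc n) → ℕ) → ∑ (allFin (suc n)) f ≡ f fzero + ∑ (allFin n) (f ∘ fsuc)
  ∑-allFin-suc n f = cong (f fzero +_)
    (trans (cong (λ xs → ∑ xs f) (sym (Lₚ.map-tabulate (λ x → x) fsuc))) (∑-map fsuc (allFin n) f))

  ∑-one-allFin : ∀ n → ∑ (allFin n) (λ _ → 1) ≡ n
  ∑-one-allFin n = trans (∑-one (allFin n)) (Lₚ.length-tabulate {n = n} (λ x → x))

  count-< : ∀ n k → k ≤ n → ∑ (allFin n) (λ i → 𝟙 (toℕ i ℕ.<? k)) ≡ k
  count-< n       zero    k≤n       = ∑-zero (allFin n)
  count-< (suc n) (suc k) (s≤s k≤n) = trans (∑-allFin-suc n (λ i → 𝟙 (toℕ i ℕ.<? suc k))) (cong suc (count-< n k k≤n))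

  -- Transpositions of positions and their action on bijections

  transpose : ∀ {n} → Fin n → Fin n → Fin n → Fin n
  transpose a b x with x ≟ a | x ≟ b
  ... | yes _ | _     = b
  ... | no _  | yes _ = a
  ... | no _  | no _  = x

  transpose-left : ∀ {n} (a b : Fin n) → transpose a b a ≡ b
  transpose-left a b with a ≟ a | a ≟ b
  ... | yes _ | _ = refl
  ... | no ¬p | _ = contradiction refl ¬p

  transpose-right : ∀ {n} (a b : Fin n) → transpose a b b ≡ a
  transpose-right a b with b ≟ a | b ≟ b
  ... | yes p | _     = p
  ... | no _  | yes _ = refl
  ... | no _  | no ¬p = contradiction refl ¬p

  transpose-other : ∀ {n} {a b x : Fin n} → x ≢ a → x ≢ b → transpose a b x ≡ x
  transpose-other {a = a} {b} {x} x≢a x≢b with x ≟ a | x ≟ b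
  ... | yes p | _     = contradiction p x≢a
  ... | no _  | yes p = contradiction p x≢b
  ... | no _  | no _  = refl

  transpose-involutive : ∀ {n} (a b x : Fin n) → transpose a b (transpose a b x) ≡ x
  transpose-involutive a b x with x ≟ a | x ≟ b
  ... | yes refl | _        = transpose-right x b
  ... | no _     | yes refl = transpose-left a x
  ... | no x≢a   | no x≢b   = transpose-other x≢a x≢b

  transpose-injective : ∀ {n} (a b : Fin n) {x y} → transpose a b x ≡ transpose a b y → x ≡ y
  transpose-injective a b {x} {y} eq =
    trans (sym (transpose-involutive a b x)) (trans (cong (transpose a b) eq) (transpose-involutive a b y))

  ∑-transpose : ∀ {n} (a b : Fin n) (f : Fin n → ℕ) → ∑ (allFin n) (f ∘ transpose a b) ≡ ∑ (allFin n) f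
  ∑-transpose a b = ∑-involution (transpose a b) (Uₚ.allFin⁺ _) (transpose-involutive a b) (λ _ → ∈-allFin _)

  swapV : ∀ {n} → Fin n → Fin n → Vec (Fin n) n → Vec (Fin n) n
  swapV a b π = V.tabulate (lookup π ∘ transpose a b)

  lookup-swapV : ∀ {n} (a b : Fin n) π x → lookup (swapV a b π) x ≡ lookup π (transpose a b x)
  lookup-swapV a b π x = Vₚ.lookup∘tabulate (lookup π ∘ transpose a b) x

  swapV-left : ∀ {n} (a b : Fin n) π → lookup (swapV a b π) a ≡ lookup π b
  swapV-left a b π = trans (lookup-swapV a b π a) (cong (lookup π) (transpose-left a b))

  swapV-right : ∀ {n} (a b : Fin n) π → lookup (swapV a b π) b ≡ lookup π a
  swapV-right a b π = trans (lookup-swapV a b π b) (cong (lookup π) (transpose-right a b))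

  swapV-other : ∀ {n} {a b : Fin n} π {x} → x ≢ a → x ≢ b → lookup (swapV a b π) x ≡ lookup π x
  swapV-other π x≢a x≢b = trans (lookup-swapV _ _ π _) (cong (lookup π) (transpose-other x≢a x≢b))

  swapV-involutive : ∀ {n} (a b : Fin n) π → swapV a b (swapV a b π) ≡ π
  swapV-involutive a b π = trans
    (Vₚ.tabulate-cong (λ x → trans (lookup-swapV a b π _) (cong (lookup π) (transpose-involutive a b x))))
    (Vₚ.tabulate∘lookup π)

  Inj : ∀ {n} → Vec (Fin n) n → Set
  Inj π = ∀ {x y} → lookup π x ≡ lookup π y → x ≡ y

  swapV-injective : ∀ {n} (a b : Fin n) π → Inj π → Inj (swapV a b π)
  swapV-injective a b π inj {x} {y} eq = transpose-injective a b
    (inj (trans (sym (lookup-swapV a b π x)) (trans eq (lookup-swapV a b π y))))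

  allB-sound : ∀ (p : A → Bool) xs → allB p xs ≡ true → ∀ {x} → x ∈ xs → p x ≡ true
  allB-sound p (y ∷ ys) eq x∈ with p y in py
  allB-sound p (y ∷ ys) eq (here refl) | true = py
  allB-sound p (y ∷ ys) eq (there x∈)  | true = allB-sound p ys eq x∈

  allB-complete : ∀ (p : A → Bool) xs → (∀ x → p x ≡ true) → allB p xs ≡ true
  allB-complete p []       h = refl
  allB-complete p (x ∷ xs) h rewrite h x = allB-complete p xs h

  injectiveB-sound : ∀ {n} (π : Vec (Fin n) n) → injectiveB π ≡ true → Inj π
  injectiveB-sound {n} π eq {x} {y} πx≡πy with allB-sound _ (allFin n) (allB-sound _ (allFin n) eq (∈-allFin x)) (∈-allFin y)
  ... | r with lookup π x ≟ lookup π y | x ≟ y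
  ... | no ¬p | _     = contradiction πx≡πy ¬p
  ... | yes _ | yes p = p
  injectiveB-sound π eq πx≡πy | () | yes _ | no _

  injectiveB-complete : ∀ {n} (π : Vec (Fin n) n) → Inj π → injectiveB π ≡ true
  injectiveB-complete {n} π inj = allB-complete _ (allFin n) (λ x → allB-complete _ (allFin n) (entry x))
    where
    entry : ∀ x y → (if ⌊ lookup π x ≟ lookup π y ⌋ then ⌊ x ≟ y ⌋ else true) ≡ true
    entry x y with lookup π x ≟ lookup π y | x ≟ y
    ... | no _  | _     = refl
    ... | yes _ | yes _ = refl
    ... | yes p | no ¬q = contradiction (inj p) ¬q

  allVecs-complete : ∀ {n m} (v : Vec (Fin n) m) → v ∈ allVecs n m
  allVecs-complete V.[]      = here refl
  allVecs-complete (i V.∷ v) = ∈-concatMap⁺ _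
    (Any.map (λ { refl → ∈-map⁺ (i V.∷_) (allVecs-complete v) }) (∈-allFin i))

  allVecs-unique : ∀ n m → Unique (allVecs n m)
  allVecs-unique n zero    = [] ∷ []
  allVecs-unique n (suc m) = Uₚ.concat⁺
    (Allₚ.map⁺ (All.universal (λ i → Uₚ.map⁺ (λ { refl → refl }) (allVecs-unique n m)) (allFin n)))
    (AllPairsₚ.map⁺ (AllPairs.map disjoint (Uₚ.allFin⁺ n)))
    where
    disjoint : ∀ {i j : Fin n} → i ≢ j → ∀ {v} → ¬ (v ∈ map (i V.∷_) (allVecs n m) × v ∈ map (j V.∷_) (allVecs n m))
    disjoint i≢j (v∈ , v∈′) with ∈-map⁻ _ v∈ | ∈-map⁻ _ v∈′
    ... | _ , _ , refl | _ , _ , refl = i≢j refl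

  allPerms-unique : ∀ n → Unique (allPerms n)
  allPerms-unique n = Uₚ.filter⁺ _ (allVecs-unique n n)

  allPerms-injective : ∀ {n} {π : Vec (Fin n) n} → π ∈ allPerms n → Inj π
  allPerms-injective {n} {π} π∈ = injectiveB-sound π (proj₂ (∈-filter⁻ _ {xs = allVecs n n} π∈))

  allPerms-complete : ∀ {n} {π : Vec (Fin n) n} → Inj π → π ∈ allPerms n
  allPerms-complete {π = π} inj = ∈-filter⁺ _ (allVecs-complete π) (injectiveB-complete π inj)

  ∑-swapV : ∀ {n} (a b : Fin n) (f : Vec (Fin n) n → ℕ) → ∑ (allPerms n) (f ∘ swapV a b) ≡ ∑ (allPerms n) f
  ∑-swapV a b = ∑-involution (swapV a b) (allPerms-unique _) (swapV-involutive a b)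
    (λ {π} π∈ → allPerms-complete (swapV-injective a b π (allPerms-injective π∈)))

  -- The form in which the symmetry is applied: an event has at most as many bijections as another
  -- if it implies the other after the transposition.
  ∑-swapV-≤ : ∀ {n} (a b : Fin n) (f g : Vec (Fin n) n → ℕ) → (∀ π → Inj π → f π ≤ g (swapV a b π)) →
              ∑ (allPerms n) f ≤ ∑ (allPerms n) g
  ∑-swapV-≤ {n} a b f g h = ℕₚ.≤-trans (∑-mono (allPerms n) (λ π π∈ → h π (allPerms-injective π∈)))
    (ℕₚ.≤-reflexive (∑-swapV a b g))

  -- A missed value could be punched out of the codomain, leaving an injection of `Fin (suc n)` into
  -- `Fin n`.
  Inj⇒surjective : ∀ {n} (π : Vec (Fin n) n) → Inj π → ∀ i → ∃ λ e → lookup π e ≡ i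
  Inj⇒surjective {suc n} π inj i with Finₚ.any? (λ e → lookup π e ≟ i)
  ... | yes p = p
  ... | no ¬p = contradiction (Finₚ.injective⇒≤ inj′) ℕₚ.1+n≰n
    where
    avoid : ∀ e → i ≢ lookup π e
    avoid e eq = ¬p (e , sym eq)
    f : Fin (suc n) → Fin n
    f e = punchOut (avoid e)
    inj′ : ∀ {x y} → f x ≡ f y → x ≡ y
    inj′ {x} {y} eq = inj (Finₚ.punchOut-injective (avoid x) (avoid y) eq)

  -- The unit against which conditional counts are measured: conditioning on weight `i` sitting at
  -- `e` means dividing by this number.
  hits : ∀ {n} → Fin n → Fin n → ℕ
  hits {n} e i = ∑ (allPerms n) (λ π → 𝟙 (lookup π e ≟ i))

  hits-≤ : ∀ {n} (e e′ i : Fin n) → hits e i ≤ hits e′ i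
  hits-≤ e e′ i = ∑-swapV-≤ e e′ _ _ (λ π _ → 𝟙-mono (lookup π e ≟ i) (lookup (swapV e e′ π) e′ ≟ i) (trans (swapV-right e e′ π)))

  ∑-preimage : ∀ {n} (π : Vec (Fin n) n) → Inj π → ∀ i → ∑ (allFin n) (λ e → 𝟙 (lookup π e ≟ i)) ≡ 1
  ∑-preimage {n} π inj i = ℕₚ.≤-antisym
    (∑-𝟙≤1 (λ e → lookup π e ≟ i) (Uₚ.allFin⁺ n) (λ x y p q → inj (trans p (sym q))))
    (let (e , πe≡i) = Inj⇒surjective π inj i in
     ℕₚ.≤-trans (ℕₚ.≤-reflexive (sym (𝟙-true (lookup π e ≟ i) πe≡i))) (∈⇒≤∑ _ (∈-allFin e)))

  ∑-∈-cong : ∀ (xs : List A) {f g : A → ℕ} → (∀ x → x ∈ xs → f x ≡ g x) → ∑ xs f ≡ ∑ xs g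
  ∑-∈-cong xs h = ℕₚ.≤-antisym (∑-mono xs (λ x x∈ → ℕₚ.≤-reflexive (h x x∈)))
                               (∑-mono xs (λ x x∈ → ℕₚ.≤-reflexive (sym (h x x∈))))

  -- Double counting: `hits e′ i` is the same for all positions `e′`, and every bijection puts `i`
  -- at exactly one of them.
  n*hits : ∀ {n} (e i : Fin n) → n * hits e i ≡ length (allPerms n)
  n*hits {n} e i = begin
    n * hits e i                                    ≡⟨ cong (_* hits e i) (∑-one-allFin n) ⟨
    ∑ (allFin n) (λ _ → 1) * hits e i               ≡⟨ ∑-*ʳ (allFin n) (hits e i) (λ _ → 1) ⟨
    ∑ (allFin n) (λ _ → 1 * hits e i)               ≡⟨ ∑-cong (allFin n) (λ e′ → trans (ℕₚ.*-identityˡ _) (ℕₚ.≤-antisym (hits-≤ e e′ i) (hits-≤ e′ e i))) ⟩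
    ∑ (allFin n) (λ e′ → hits e′ i)                 ≡⟨ ∑-swap (allFin n) (allPerms n) _ ⟩
    ∑ (allPerms n) (λ π → ∑ (allFin n) (λ e′ → 𝟙 (lookup π e′ ≟ i))) ≡⟨ ∑-∈-cong (allPerms n) (λ π π∈ → ∑-preimage π (allPerms-injective π∈) i) ⟩
    ∑ (allPerms n) (λ _ → 1)                        ≡⟨ ∑-one (allPerms n) ⟩
    length (allPerms n)                             ∎
    where open ≡-Reasoning

  -- Rank and closure in a matroid

  ∣p∣≡∑ : (p : Subset n) → ∣ p ∣ ≡ ∑ (allFin n) (λ e → 𝟙 (e ∈? p))
  ∣p∣≡∑ V.[] = refl
  ∣p∣≡∑ {suc n} (true  V.∷ p) = trans (cong suc (∣p∣≡∑ p)) (sym (∑-allFin-suc n (λ e → 𝟙 (e ∈? (true V.∷ p)))))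
  ∣p∣≡∑ {suc n} (false V.∷ p) = trans (∣p∣≡∑ p) (sym (∑-allFin-suc n (λ e → 𝟙 (e ∈? (false V.∷ p)))))

  ⟦_⟧ : {P : Fin n → Set} → (∀ e → Dec (P e)) → Subset n
  ⟦ P? ⟧ = V.tabulate (does ∘ P?)

  ∈-⟦⟧⁻ : {P : Fin n → Set} (P? : ∀ e → Dec (P e)) → ∀ {e} → e ∈ₛ ⟦ P? ⟧ → P e
  ∈-⟦⟧⁻ P? {e} e∈ with P? e | trans (sym (Vₚ.lookup∘tabulate (does ∘ P?) e)) (Vₚ.[]=⇒lookup e∈)
  ... | yes p | _ = p

  ∈-⟦⟧⁺ : {P : Fin n → Set} (P? : ∀ e → Dec (P e)) → ∀ {e} → P e → e ∈ₛ ⟦ P? ⟧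
  ∈-⟦⟧⁺ P? {e} p = Vₚ.lookup⇒[]= e _ (trans (Vₚ.lookup∘tabulate (does ∘ P?) e) (dec-true′ (P? e) p))
    where
    dec-true′ : ∀ {Q : Set} (d : Dec Q) → Q → does d ≡ true
    dec-true′ (yes _) _ = refl
    dec-true′ (no ¬q) q = contradiction q ¬q

  ⟦⟧-cong : {P Q : Fin n → Set} (P? : ∀ e → Dec (P e)) (Q? : ∀ e → Dec (Q e)) →
            (∀ e → P e → Q e) → (∀ e → Q e → P e) → ⟦ P? ⟧ ≡ ⟦ Q? ⟧
  ⟦⟧-cong P? Q? f g = Sₚ.⊆-antisym (λ e∈ → ∈-⟦⟧⁺ Q? (f _ (∈-⟦⟧⁻ P? e∈))) (λ e∈ → ∈-⟦⟧⁺ P? (g _ (∈-⟦⟧⁻ Q? e∈)))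

  insert-⊆ : ∀ {e} {X S : Subset n} → e ∈ₛ S → X ⊆ S → ⁅ e ⁆ ∪ X ⊆ S
  insert-⊆ {e = e} {X} e∈ X⊆ x∈ with Sₚ.x∈p∪q⁻ ⁅ e ⁆ X x∈
  ... | inj₁ x∈e rewrite Sₚ.x∈⁅y⁆⇒x≡y e x∈e = e∈
  ... | inj₂ x∈X = X⊆ x∈X

  ∈-insert : ∀ (e : Fin n) (X : Subset n) → e ∈ₛ ⁅ e ⁆ ∪ X
  ∈-insert e X = Sₚ.p⊆p∪q X (Sₚ.x∈⁅x⁆ e)

  ⊆-insert : ∀ (e : Fin n) (X : Subset n) → X ⊆ ⁅ e ⁆ ∪ X
  ⊆-insert e X = Sₚ.q⊆p∪q ⁅ e ⁆ X

  insert-mono : ∀ (e : Fin n) {X Y : Subset n} → X ⊆ Y → ⁅ e ⁆ ∪ X ⊆ ⁅ e ⁆ ∪ Y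
  insert-mono e {X} {Y} X⊆Y = insert-⊆ (∈-insert e Y) (⊆-insert e Y ∘ X⊆Y)

  ∉⇒∣insert∣ : ∀ {e : Fin n} {X : Subset n} → e ∉ X → ∣ X ∣ < ∣ ⁅ e ⁆ ∪ X ∣
  ∉⇒∣insert∣ {e = e} {X} e∉ = Sₚ.p⊂q⇒∣p∣<∣q∣ (⊆-insert e X , e , ∈-insert e X , e∉)

  ∈-insert⁻ : ∀ {e x : Fin n} {X : Subset n} → x ∈ₛ ⁅ e ⁆ ∪ X → x ≢ e → x ∈ₛ X
  ∈-insert⁻ {e = e} {X = X} x∈ x≢e with Sₚ.x∈p∪q⁻ ⁅ e ⁆ X x∈
  ... | inj₁ x∈e = contradiction (Sₚ.x∈⁅y⁆⇒x≡y e x∈e) x≢e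
  ... | inj₂ x∈X = x∈X

  allSubsets-complete : (S : Subset n) → S ∈ allSubsets n
  allSubsets-complete V.[] = here refl
  allSubsets-complete {suc n} (false V.∷ S) = ∈-++⁺ˡ (∈-map⁺ (outside V.∷_) (allSubsets-complete S))
  allSubsets-complete {suc n} (true  V.∷ S) =
    ∈-++⁺ʳ (map (outside V.∷_) (allSubsets n)) (∈-map⁺ (inside V.∷_) (allSubsets-complete S))

  ≤-max : ∀ {A : Set} (f : A → ℕ) {xs x} → x ∈ xs → f x ≤ foldr _⊔_ 0 (map f xs)
  ≤-max f (here refl) = ℕₚ.m≤m⊔n _ _
  ≤-max f (there x∈)  = ℕₚ.≤-trans (≤-max f x∈) (ℕₚ.m≤n⊔m _ _)

  max-attained : ∀ {A : Set} (f : A → ℕ) xs → foldr _⊔_ 0 (map f xs) ≡ 0 ⊎ (∃ λ x → x ∈ xs × f x ≡ foldr _⊔_ 0 (map f xs))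
  max-attained f []       = inj₁ refl
  max-attained f (x ∷ xs) with ℕₚ.⊔-sel (f x) (foldr _⊔_ 0 (map f xs))
  ... | inj₁ eq = inj₂ (x , here refl , sym eq)
  ... | inj₂ eq with max-attained f xs
  ...   | inj₁ z             = inj₁ (trans eq z)
  ...   | inj₂ (y , y∈ , e′) = inj₂ (y , there y∈ , trans e′ (sym eq))

  module _ (M : Matroid n) where
    open Matroid M

    indep⇒≤rank : ∀ {X S} → indep X ≡ true → X ⊆ S → ∣ X ∣ ≤ rank M S
    indep⇒≤rank {X} {S} iX X⊆S = ≤-max ∣_∣
      (∈-filter⁺ (λ X → X ⊆? S) (∈-filter⁺ (λ X → indep X Bool.≟ true) (allSubsets-complete X) iX) X⊆S)

    basis : ∀ S → ∃ λ X → indep X ≡ true × X ⊆ S × ∣ X ∣ ≡ rank M S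
    basis S with max-attained ∣_∣ (filter (λ X → X ⊆? S) (filter (λ X → indep X Bool.≟ true) (allSubsets n)))
    ... | inj₁ eq = ⊥ , indep-∅ , Sₚ.⊆-min S , trans (Sₚ.∣⊥∣≡0 n) (sym eq)
    ... | inj₂ (X , X∈ , eq) =
      let (X∈′ , X⊆S) = ∈-filter⁻ (λ X → X ⊆? S) {xs = filter (λ X → indep X Bool.≟ true) (allSubsets n)} X∈
          (_ , iX) = ∈-filter⁻ (λ X → indep X Bool.≟ true) {xs = allSubsets n} X∈′
      in X , iX , X⊆S , eq

    rank≤∣∣ : ∀ S → rank M S ≤ ∣ S ∣
    rank≤∣∣ S = let (X , _ , X⊆S , eq) = basis S in subst (_≤ ∣ S ∣) eq (Sₚ.p⊆q⇒∣p∣≤∣q∣ X⊆S)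

    rk≤n : rk M ≤ n
    rk≤n = ℕₚ.≤-trans (rank≤∣∣ ⊤) (Sₚ.∣p∣≤n ⊤)

    rank-mono : ∀ {S T} → S ⊆ T → rank M S ≤ rank M T
    rank-mono {S} {T} S⊆T = let (X , iX , X⊆S , eq) = basis S in subst (_≤ rank M T) eq (indep⇒≤rank iX (S⊆T ∘ X⊆S))

    basis-maximal : ∀ {X S e} → ∣ X ∣ ≡ rank M S → X ⊆ S → e ∈ₛ S → e ∉ X → indep (⁅ e ⁆ ∪ X) ≢ true
    basis-maximal {X} {S} {e} eq X⊆S e∈S e∉X i = ℕₚ.<⇒≱ (∉⇒∣insert∣ e∉X)
      (subst (∣ ⁅ e ⁆ ∪ X ∣ ≤_) (sym eq) (indep⇒≤rank i (insert-⊆ e∈S X⊆S)))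

    -- If `Y` exceeded `X` by two, exchange would add to `X` an element `y` of `Y` and then a
    -- further `z`. As `X` is maximal inside `S`, each of them must be `e`, yet `z` is not in
    -- `⁅ y ⁆ ∪ X`.
    rank-insert : ∀ e S → rank M (⁅ e ⁆ ∪ S) ≤ suc (rank M S)
    rank-insert e S with basis S | basis (⁅ e ⁆ ∪ S)
    ... | X , iX , X⊆S , ∣X∣ | Y , iY , Y⊆ , ∣Y∣ = ℕₚ.≮⇒≥ λ big →
      let big′ : suc ∣ X ∣ < ∣ Y ∣
          big′ = subst (λ k → suc k < ∣ Y ∣) (sym ∣X∣) (subst (suc (rank M S) <_) (sym ∣Y∣) big)
          (y , y∈Y , y∉X , iyX) = indep-exch iX iY (ℕₚ.<-trans (ℕₚ.n<1+n _) big′)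
          step : ∀ z → z ∈ₛ Y → z ∉ X → indep (⁅ z ⁆ ∪ X) ≡ true → z ≡ e
          step z z∈Y z∉X i = decidable-stable (z ≟ e)
            (λ z≢e → basis-maximal ∣X∣ X⊆S (∈-insert⁻ (Y⊆ z∈Y) z≢e) z∉X i)
          (z , z∈Y , z∉yX , izyX) = indep-exch iyX iY (ℕₚ.≤-<-trans (∣insert∣≤ y X) big′)
          z∉X = z∉yX ∘ ⊆-insert y X
          z≡e = step z z∈Y z∉X (indep-⊆ (insert-mono z (⊆-insert y X)) izyX)
          y≡e = step y y∈Y y∉X iyX
      in z∉yX (subst (_∈ₛ ⁅ y ⁆ ∪ X) (trans y≡e (sym z≡e)) (∈-insert y X))
      where
      ∣insert∣≤ : ∀ y X → ∣ ⁅ y ⁆ ∪ X ∣ ≤ suc ∣ X ∣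
      ∣insert∣≤ y X = subst (λ k → ∣ ⁅ y ⁆ ∪ X ∣ ≤ k + ∣ X ∣) (Sₚ.∣⁅x⁆∣≡1 y) (∣∪∣≤ ⁅ y ⁆ X)
        where
        ∣∪∣≤ : ∀ {m} (p q : Subset m) → ∣ p ∪ q ∣ ≤ ∣ p ∣ + ∣ q ∣
        ∣∪∣≤ V.[] V.[] = z≤n
        ∣∪∣≤ (false V.∷ p) (false V.∷ q) = ∣∪∣≤ p q
        ∣∪∣≤ (false V.∷ p) (true  V.∷ q) = ℕₚ.≤-trans (s≤s (∣∪∣≤ p q)) (ℕₚ.≤-reflexive (sym (ℕₚ.+-suc ∣ p ∣ ∣ q ∣)))
        ∣∪∣≤ (true  V.∷ p) (false V.∷ q) = s≤s (∣∪∣≤ p q)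
        ∣∪∣≤ (true  V.∷ p) (true  V.∷ q) = s≤s (ℕₚ.≤-trans (∣∪∣≤ p q) (ℕₚ.+-monoʳ-≤ ∣ p ∣ (ℕₚ.n≤1+n _)))

    spanned? : ∀ U e → Dec (rank M (⁅ e ⁆ ∪ U) ≤ rank M U)
    spanned? U e = rank M (⁅ e ⁆ ∪ U) ℕ.≤? rank M U

    cl : Subset n → Subset n
    cl U = ⟦ spanned? U ⟧

    -- A larger independent set inside the closure would exchange some `y` into the basis `X` of
    -- `U`; then `⁅ y ⁆ ∪ U` has larger rank than `U`, although `y` is spanned.
    rank-cl : ∀ U → rank M (cl U) ≤ rank M U
    rank-cl U with basis U | basis (cl U)
    ... | X , iX , X⊆U , ∣X∣ | Y , iY , Y⊆ , ∣Y∣ = ℕₚ.≮⇒≥ λ big →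
      let (y , y∈Y , y∉X , iyX) = indep-exch iX iY (subst (_< ∣ Y ∣) (sym ∣X∣) (subst (rank M U <_) (sym ∣Y∣) big))
      in ℕₚ.<⇒≱ (∉⇒∣insert∣ y∉X) (ℕₚ.≤-trans (indep⇒≤rank iyX (insert-mono y X⊆U))
           (subst (rank M (⁅ y ⁆ ∪ U) ≤_) (sym ∣X∣) (∈-⟦⟧⁻ (spanned? U) (Y⊆ y∈Y))))

    ⊆-cl : ∀ U → U ⊆ cl U
    ⊆-cl U e∈U = ∈-⟦⟧⁺ (spanned? U) (rank-mono (insert-⊆ e∈U (λ x∈ → x∈)))

    -- If e is outside the closure, U ∪ {e} has an independent set Y bigger than rank U; extending S
    -- from Y must use e at some point, since the extension no longer fits into U.
    indep-insert : ∀ {U S e} → e ∉ cl U → S ⊆ U → indep S ≡ true → indep (⁅ e ⁆ ∪ S) ≡ true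
    indep-insert {U} {S} {e} e∉ S⊆U iS with basis (⁅ e ⁆ ∪ U)
    ... | Y , iY , Y⊆ , ∣Y∣ = grow (∣ Y ∣ ∸ ∣ S ∣) S (λ x∈ → x∈) S⊆U iS (ℕₚ.m≤n+m∸n ∣ Y ∣ ∣ S ∣)
      where
      rankU<∣Y∣ : rank M U < ∣ Y ∣
      rankU<∣Y∣ = subst (rank M U <_) (sym ∣Y∣) (ℕₚ.≰⇒> (e∉ ∘ ∈-⟦⟧⁺ (spanned? U)))
      grow : ∀ k X → S ⊆ X → X ⊆ U → indep X ≡ true → ∣ Y ∣ ≤ ∣ X ∣ + k → indep (⁅ e ⁆ ∪ S) ≡ true
      grow zero X S⊆X X⊆U iX le = contradiction (ℕₚ.≤-trans (subst (∣ Y ∣ ≤_) (ℕₚ.+-identityʳ _) le) (indep⇒≤rank iX X⊆U)) (ℕₚ.<⇒≱ rankU<∣Y∣)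
      grow (suc k) X S⊆X X⊆U iX le with indep-exch iX iY (ℕₚ.≤-<-trans (indep⇒≤rank iX X⊆U) rankU<∣Y∣)
      ... | y , y∈Y , y∉X , iyX with y ≟ e
      ...   | yes refl = indep-⊆ (insert-mono e S⊆X) iyX
      ...   | no y≢e   = grow k (⁅ y ⁆ ∪ X) (⊆-insert y X ∘ S⊆X) (insert-⊆ (∈-insert⁻ (Y⊆ y∈Y) y≢e) X⊆U) iyX
                          (ℕₚ.≤-trans le (ℕₚ.≤-trans (ℕₚ.≤-reflexive (ℕₚ.+-suc ∣ X ∣ k)) (ℕₚ.+-monoˡ-≤ k (∉⇒∣insert∣ y∉X))))

    -- The density hypothesis says nothing about sets of loops, hence the added non-loop x.
    ∣cl∣-bound : UniformlyDense M → 0 < rk M → ∀ U → ∣ cl U ∣ * rk M ≤ n * suc ∣ U ∣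
    ∣cl∣-bound ud 0<r U with basis ⊤
    ... | X , iX , _ , ∣X∣ with indep-exch indep-∅ iX (subst (_< ∣ X ∣) (sym (Sₚ.∣⊥∣≡0 n)) (subst (0 <_) (sym ∣X∣) 0<r))
    ... | x , _ , _ , ix = begin
        ∣ cl U ∣ * rk M                 ≤⟨ ℕₚ.*-monoˡ-≤ (rk M) (Sₚ.∣q∣≤∣p∪q∣ ⁅ x ⁆ (cl U)) ⟩
        ∣ ⁅ x ⁆ ∪ cl U ∣ * rk M         ≤⟨ ud (⁅ x ⁆ ∪ cl U) pos ⟩
        n * rank M (⁅ x ⁆ ∪ cl U)       ≤⟨ ℕₚ.*-monoʳ-≤ n (ℕₚ.≤-trans (rank-insert x (cl U)) (s≤s (ℕₚ.≤-trans (rank-cl U) (rank≤∣∣ U)))) ⟩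
        n * suc ∣ U ∣                   ∎
      where
      open ℕₚ.≤-Reasoning
      pos : 0 < rank M (⁅ x ⁆ ∪ cl U)
      pos = ℕₚ.≤-trans (ℕₚ.≤-trans (ℕₚ.≤-reflexive (sym (Sₚ.∣⁅x⁆∣≡1 x))) (Sₚ.∣p∣≤∣p∪q∣ ⁅ x ⁆ ⊥))
                       (indep⇒≤rank ix (insert-mono x (Sₚ.⊆-min (cl U))))

  -- Symmetry of the random bijection, and rivals of an element

  𝟙-× : ∀ {P Q : Set} (p : Dec P) (q : Dec Q) → 𝟙 (p ×-dec q) ≡ 𝟙 p * 𝟙 q
  𝟙-× (yes _) (yes _) = refl
  𝟙-× (yes _) (no _)  = refl
  𝟙-× (no _)  q       = refl

  𝟙-⊎ : ∀ {P Q R : Set} (p : Dec P) (q : Dec Q) (r : Dec R) → (P → R) → (Q → R) → (P → ¬ Q) → 𝟙 p + 𝟙 q ≤ 𝟙 r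
  𝟙-⊎ (yes p) (yes q) r f g d = contradiction q (d p)
  𝟙-⊎ (yes p) (no _)  r f g d = ℕₚ.≤-reflexive (sym (𝟙-true r (f p)))
  𝟙-⊎ (no _)  q       r f g d = 𝟙-mono q r g

  𝟙-complement : ∀ {P Q : Set} (p : Dec P) (q : Dec Q) → (P → ¬ Q) → (¬ P → Q) → 𝟙 p + 𝟙 q ≡ 1
  𝟙-complement (yes p) q f g = cong suc (𝟙-false q (f p))
  𝟙-complement (no ¬p) q f g = 𝟙-true q (g ¬p)

  𝟙≤ : ∀ {P : Set} (p : Dec P) {m} → (P → 1 ≤ m) → 𝟙 p ≤ m
  𝟙≤ (yes p) f = f p
  𝟙≤ (no _)  f = z≤n

  ∑-single : ∀ (b : Fin n) → 1 ≤ ∑ (allFin n) (λ x → 𝟙 (x ≟ b))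
  ∑-single b = ℕₚ.≤-trans (ℕₚ.≤-reflexive (sym (𝟙-true (b ≟ b) refl))) (∈⇒≤∑ (λ x → 𝟙 (x ≟ b)) (∈-allFin b))

  count-≥ : ∀ {h} → h ≤ n → ∑ (allFin n) (λ e → 𝟙 (h ≤? toℕ e)) + h ≡ n
  count-≥ {n} {h} h≤n = begin
    ∑ (allFin n) (λ e → 𝟙 (h ≤? toℕ e)) + h                                  ≡⟨ cong (∑ (allFin n) (λ e → 𝟙 (h ≤? toℕ e)) +_) (count-< n h h≤n) ⟨
    ∑ (allFin n) (λ e → 𝟙 (h ≤? toℕ e)) + ∑ (allFin n) (λ e → 𝟙 (toℕ e <? h)) ≡⟨ ∑-+ (allFin n) _ _ ⟨
    ∑ (allFin n) (λ e → 𝟙 (h ≤? toℕ e) + 𝟙 (toℕ e <? h))                     ≡⟨ ∑-cong (allFin n) complement ⟩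
    ∑ (allFin n) (λ _ → 1)                                                   ≡⟨ ∑-one-allFin n ⟩
    n ∎
    where
    open ≡-Reasoning
    complement : ∀ (e : Fin n) → 𝟙 (h ≤? toℕ e) + 𝟙 (toℕ e <? h) ≡ 1
    complement e = 𝟙-complement (h ≤? toℕ e) (toℕ e <? h) ℕₚ.≤⇒≯ ℕₚ.≰⇒>

  -- Relative ranks within a pool of positions

  module _ {P : Fin n → Set} (P? : ∀ x → Dec (P x)) (π : Vec (Fin n) n) where

    -- The argument is a weight index rather than an element, so that it can stay fixed while a
    -- transposition moves the element that carries it.
    below : ℕ → ℕ
    below v = ∑ (allFin n) (λ y → 𝟙 (P? y ×-dec (toℕ (lookup π y) <? v)))

    pos : Fin n → ℕ
    pos x = below (toℕ (lookup π x))

    -- `x` itself is counted in `pos y` but not in `pos x`.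
    below-strict : ∀ x y → P x → toℕ (lookup π x) < toℕ (lookup π y) → pos x < pos y
    below-strict x y px x<y = begin-strict
      pos x <⟨ ℕₚ.m<n+m (pos x) (∑-single x) ⟩
      ∑ (allFin n) (λ z → 𝟙 (z ≟ x)) + pos x ≡⟨ ∑-+ (allFin n) _ _ ⟨
      ∑ (allFin n) (λ z → 𝟙 (z ≟ x) + 𝟙 (P? z ×-dec (toℕ (lookup π z) <? toℕ (lookup π x))))
        ≤⟨ ∑-mono (allFin n) (λ z _ → 𝟙-⊎ (z ≟ x) (P? z ×-dec (toℕ (lookup π z) <? toℕ (lookup π x))) (P? z ×-dec (toℕ (lookup π z) <? toℕ (lookup π y)))
             (λ { refl → px , x<y }) (λ (pz , z<x) → pz , ℕₚ.<-trans z<x x<y) (λ { refl (_ , x<x) → ℕₚ.<-irrefl refl x<x })) ⟩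
      pos y ∎
      where open ℕₚ.≤-Reasoning

    -- By `below-strict` relative ranks are distinct on the pool, so each of the ranks 0, ..., q is
    -- taken at most once.
    count-top : Inj π → ∀ q → ∑ (allFin n) (λ x → 𝟙 (P? x ×-dec (pos x ≤? q))) ≤ suc q
    count-top inj q = begin
      ∑ (allFin n) (λ x → 𝟙 (P? x ×-dec (pos x ≤? q)))
        ≤⟨ ∑-mono (allFin n) (λ x _ → split x) ⟩
      ∑ (allFin n) (λ x → ∑ (upTo (suc q)) (λ ρ → 𝟙 (P? x ×-dec (pos x ℕ.≟ ρ))))
        ≡⟨ ∑-swap (allFin n) (upTo (suc q)) _ ⟩
      ∑ (upTo (suc q)) (λ ρ → ∑ (allFin n) (λ x → 𝟙 (P? x ×-dec (pos x ℕ.≟ ρ))))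
        ≤⟨ ∑-mono (upTo (suc q)) (λ ρ _ → ∑-𝟙≤1 (λ x → P? x ×-dec (pos x ℕ.≟ ρ)) (Uₚ.allFin⁺ n)
             (λ { x y (px , refl) (py , eq) → same x y px py eq })) ⟩
      ∑ (upTo (suc q)) (λ _ → 1) ≡⟨ ∑-one (upTo (suc q)) ⟩
      length (upTo (suc q))      ≡⟨ Lₚ.length-upTo (suc q) ⟩
      suc q ∎
      where
      open ℕₚ.≤-Reasoning
      split : ∀ x → 𝟙 (P? x ×-dec (pos x ≤? q)) ≤ ∑ (upTo (suc q)) (λ ρ → 𝟙 (P? x ×-dec (pos x ℕ.≟ ρ)))
      split x = 𝟙≤ (P? x ×-dec (pos x ≤? q)) λ (px , le) → ℕₚ.≤-trans (ℕₚ.≤-reflexive (sym (𝟙-true (P? x ×-dec (pos x ℕ.≟ pos x)) (px , refl))))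
                              (∈⇒≤∑ (λ ρ → 𝟙 (P? x ×-dec (pos x ℕ.≟ ρ))) (∈-upTo⁺ (s≤s le)))
      same : ∀ x y → P x → P y → pos y ≡ pos x → x ≡ y
      same x y px py eq with ℕₚ.<-cmp (toℕ (lookup π x)) (toℕ (lookup π y))
      ... | tri< lt _ _ = contradiction (sym eq) (ℕₚ.<⇒≢ (below-strict x y px lt))
      ... | tri≈ _ e _  = inj (Finₚ.toℕ-injective e)
      ... | tri> _ _ gt = contradiction eq (ℕₚ.<⇒≢ (below-strict y x py gt))

  -- Both transposed positions lie in the pool, so the pool holds the same weights before and after.
  below-swap : ∀ {P : Fin n → Set} (P? : ∀ x → Dec (P x)) {a b} → P a → P b → ∀ π v →
               below P? (swapV a b π) v ≤ below P? π v
  below-swap {n} {P} P? {a} {b} pa pb π v = begin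
    below P? (swapV a b π) v
      ≤⟨ ∑-mono (allFin n) (λ y _ → 𝟙-mono (P? y ×-dec (toℕ (lookup (swapV a b π) y) <? v)) (P? (transpose a b y) ×-dec (toℕ (lookup π (transpose a b y)) <? v))
           (λ (py , lt) → closed y py , subst (λ z → toℕ z < v) (lookup-swapV a b π y) lt)) ⟩
    ∑ (allFin n) (λ y → 𝟙 (P? (transpose a b y) ×-dec (toℕ (lookup π (transpose a b y)) <? v)))
      ≡⟨ ∑-transpose a b (λ y → 𝟙 (P? y ×-dec (toℕ (lookup π y) <? v))) ⟩
    below P? π v ∎
    where
    open ℕₚ.≤-Reasoning
    closed : ∀ y → P y → P (transpose a b y)
    closed y py with y ≟ a | y ≟ b
    ... | yes _ | _     = pb
    ... | no _  | yes _ = pa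
    ... | no _  | no _  = py

  -- A smaller index is a larger weight, so this counts the sampled elements of weight at least w v.
  atLeast : ℕ → Vec (Fin n) n → Fin n → ℕ
  atLeast {n} h π v = ∑ (allFin n) (λ a → 𝟙 ((toℕ a <? h) ×-dec (toℕ (lookup π a) ≤? toℕ v)))

  module _ (M : Matroid n) (h q : ℕ) where

    -- The last clause says that `b` passes the threshold: at most `q` sampled weights reach its
    -- own. Excluding the weight `i` instead of a position keeps the notion stable when `i` moves.
    Rival : Vec (Fin n) n → Fin n → Fin n → Set
    Rival π i b = h ≤ toℕ b × lookup π b ≢ i × atLeast h π (lookup π b) ≤ q

    rival? : ∀ π i b → Dec (Rival π i b)
    rival? π i b = (h ≤? toℕ b) ×-dec ¬? (lookup π b ≟ i) ×-dec (atLeast h π (lookup π b) ≤? q)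

    rivals : Vec (Fin n) n → Fin n → Subset n
    rivals π i = ⟦ rival? π i ⟧

    -- Position `e` and weight `i` are kept apart: free positions are first counted with the
    -- bijection fixed, and only then is `i` moved onto each of them.
    Free : Vec (Fin n) n → Fin n → Fin n → Set
    Free π i e = h ≤ toℕ e × e ∉ cl M (rivals π i)

    free? : ∀ π i e → Dec (Free π i e)
    free? π i e = (h ≤? toℕ e) ×-dec ¬? (e ∈? cl M (rivals π i))

    -- Exactly one position carries `i`, so this counts the bijections in which that position is
    -- free.
    goodCount : Fin n → ℕ
    goodCount i = ∑ (allPerms n) (λ π → ∑ (allFin n) (λ e → 𝟙 ((lookup π e ≟ i) ×-dec free? π i e)))

    atLeast-swap : ∀ {e e′} → h ≤ toℕ e → h ≤ toℕ e′ → ∀ π v → atLeast h (swapV e e′ π) v ≡ atLeast h π v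
    atLeast-swap {e} {e′} e∈ e′∈ π v = ℕₚ.≤-antisym
      (∑-mono (allFin n) (λ a _ → 𝟙-mono (dec (swapV e e′ π) a) (dec π a) (λ (a< , le) → a< , subst (λ z → toℕ z ≤ toℕ v) (fix a a<) le)))
      (∑-mono (allFin n) (λ a _ → 𝟙-mono (dec π a) (dec (swapV e e′ π) a) (λ (a< , le) → a< , subst (λ z → toℕ z ≤ toℕ v) (sym (fix a a<)) le)))
      where
      dec : ∀ π a → Dec (toℕ a < h × toℕ (lookup π a) ≤ toℕ v)
      dec π a = (toℕ a <? h) ×-dec (toℕ (lookup π a) ≤? toℕ v)
      fix : ∀ a → toℕ a < h → lookup (swapV e e′ π) a ≡ lookup π a
      fix a a< = swapV-other π (λ { refl → ℕₚ.<⇒≱ a< e∈ }) (λ { refl → ℕₚ.<⇒≱ a< e′∈ })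

    -- The sample is untouched. Weight `i`, now at `e′`, is excluded by definition; the weight
    -- arriving at `e` did not make `e′` a rival and, against the same threshold, does not make `e`
    -- one.
    rivals-swap : ∀ {e e′ i} → h ≤ toℕ e → h ≤ toℕ e′ → ∀ π → lookup π e ≡ i → e′ ∉ rivals π i →
                  rivals (swapV e e′ π) i ≡ rivals π i
    rivals-swap {e} {e′} {i} e∈ e′∈ π πe≡i e′∉ = ⟦⟧-cong (rival? (swapV e e′ π) i) (rival? π i) to from
      where
      move : ∀ {x y} → lookup (swapV e e′ π) x ≡ lookup π y → h ≤ toℕ y →
             Rival (swapV e e′ π) i x → Rival π i y
      move {x} {y} eq y∈ (_ , ≢i , le) = y∈ , (λ p → ≢i (trans eq p)) ,
        subst (_≤ q) (trans (atLeast-swap e∈ e′∈ π _) (cong (atLeast h π) eq)) le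
      to : ∀ x → Rival (swapV e e′ π) i x → Rival π i x
      to x r@(x∈ , ≢i , _) with x ≟ e | x ≟ e′
      ... | yes refl | _        = contradiction (∈-⟦⟧⁺ (rival? π i) (move (swapV-left x e′ π) e′∈ r)) e′∉
      ... | no _     | yes refl = contradiction (trans (swapV-right e x π) πe≡i) ≢i
      ... | no x≢e   | no x≢e′  = move (swapV-other π x≢e x≢e′) x∈ r
      from : ∀ x → Rival π i x → Rival (swapV e e′ π) i x
      from x r@(x∈ , ≢i , le) with x ≟ e | x ≟ e′
      ... | yes refl | _        = contradiction πe≡i ≢i
      ... | no _     | yes refl = contradiction (∈-⟦⟧⁺ (rival? π i) r) e′∉
      ... | no x≢e   | no x≢e′  = x∈ , (λ p → ≢i (trans (sym eq) p)) ,
        subst (_≤ q) (sym (trans (atLeast-swap e∈ e′∈ π _) (cong (atLeast h π) eq))) le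
        where eq = swapV-other π x≢e x≢e′

    freeCount : Vec (Fin n) n → Fin n → ℕ
    freeCount π i = ∑ (allFin n) (λ e → 𝟙 (free? π i e))

    -- This is the uniformity of the position of `i` given the rivals: the swap moves `i` from `e`
    -- to `e′` and leaves the rivals as they are.
    free-exchange : ∀ {e i} e′ → h ≤ toℕ e →
      ∑ (allPerms n) (λ π → 𝟙 ((lookup π e ≟ i) ×-dec free? π i e′)) ≤
      ∑ (allPerms n) (λ π → 𝟙 ((lookup π e′ ≟ i) ×-dec free? π i e′))
    free-exchange {e} {i} e′ e∈ = ∑-swapV-≤ e e′ _ _ (λ π _ →
      𝟙-mono ((lookup π e ≟ i) ×-dec free? π i e′) ((lookup (swapV e e′ π) e′ ≟ i) ×-dec free? (swapV e e′ π) i e′)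
        (λ (πe≡i , e′∈ , e′∉) → trans (swapV-right e e′ π) πe≡i , e′∈ ,
           -- A free `e′` is outside the closure, hence no rival, as `rivals-swap` requires.
           subst (λ U → e′ ∉ cl M U) (sym (rivals-swap e∈ e′∈ π πe≡i (e′∉ ∘ ⊆-cl M (rivals π i)))) e′∉))

    ∑-free≤good : ∀ {e i} → h ≤ toℕ e → ∑ (allPerms n) (λ π → 𝟙 (lookup π e ≟ i) * freeCount π i) ≤ goodCount i
    ∑-free≤good {e} {i} e∈ = begin
      ∑ (allPerms n) (λ π → 𝟙 (lookup π e ≟ i) * freeCount π i)
        ≡⟨ ∑-cong (allPerms n) (λ π → trans (sym (∑-*ˡ (allFin n) (𝟙 (lookup π e ≟ i)) (λ e′ → 𝟙 (free? π i e′)))) (∑-cong (allFin n) (λ e′ → sym (𝟙-× (lookup π e ≟ i) (free? π i e′))))) ⟩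
      ∑ (allPerms n) (λ π → ∑ (allFin n) (λ e′ → 𝟙 ((lookup π e ≟ i) ×-dec free? π i e′)))
        ≡⟨ ∑-swap (allPerms n) (allFin n) _ ⟩
      ∑ (allFin n) (λ e′ → ∑ (allPerms n) (λ π → 𝟙 ((lookup π e ≟ i) ×-dec free? π i e′)))
        ≤⟨ ∑-mono (allFin n) (λ e′ _ → free-exchange e′ e∈) ⟩
      ∑ (allFin n) (λ e′ → ∑ (allPerms n) (λ π → 𝟙 ((lookup π e′ ≟ i) ×-dec free? π i e′)))
        ≡⟨ ∑-swap (allPerms n) (allFin n) _ ⟨
      goodCount i ∎
      where open ℕₚ.≤-Reasoning

    -- A fixed b ∈ B is equally likely to hold any of the h + 1 relative positions within A ∪ {b}, and
    -- it is a rival only if it is among the first q + 1 of them.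
    rival-rare : h ≤ n → ∀ {e i} b → h ≤ toℕ e →
      suc h * ∑ (allPerms n) (λ π → 𝟙 ((lookup π e ≟ i) ×-dec (b ∈? rivals π i))) ≤ 𝟙 (h ≤? toℕ b) * (suc q * hits e i)
    rival-rare h≤n {e} {i} b e∈ = cases (b ≟ e) (h ≤? toℕ b)
      where
      open ℕₚ.≤-Reasoning
      rare = ∑ (allPerms n) (λ π → 𝟙 ((lookup π e ≟ i) ×-dec (b ∈? rivals π i)))
      never : (∀ π → lookup π e ≡ i → ¬ Rival π i b) → ∀ {m} → suc h * rare ≤ m
      never no-rival = ℕₚ.≤-trans (ℕₚ.≤-reflexive (trans (cong (suc h *_) (trans
        (∑-cong (allPerms n) (λ π → 𝟙-false ((lookup π e ≟ i) ×-dec (b ∈? rivals π i))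
          (λ (πe≡i , b∈) → no-rival π πe≡i (∈-⟦⟧⁻ (rival? π i) b∈))))
        (∑-zero (allPerms n)))) (ℕₚ.*-zeroʳ (suc h)))) z≤n
      Pool : Fin n → Set
      Pool x = x ≡ b ⊎ toℕ x < h
      pool? : ∀ x → Dec (Pool x)
      pool? x = (x ≟ b) ⊎-dec (toℕ x <? h)
      size : h ≤ toℕ b → suc h ≤ ∑ (allFin n) (λ x → 𝟙 (pool? x))
      size b∈ = begin
        1 + h ≤⟨ ℕₚ.+-mono-≤ (∑-single b) (ℕₚ.≤-reflexive (sym (count-< n h h≤n))) ⟩
        ∑ (allFin n) (λ x → 𝟙 (x ≟ b)) + ∑ (allFin n) (λ x → 𝟙 (toℕ x <? h)) ≡⟨ ∑-+ (allFin n) _ _ ⟨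
        ∑ (allFin n) (λ x → 𝟙 (x ≟ b) + 𝟙 (toℕ x <? h))
          ≤⟨ ∑-mono (allFin n) (λ x _ → 𝟙-⊎ (x ≟ b) (toℕ x <? h) (pool? x) inj₁ inj₂ (λ { refl lt → ℕₚ.<⇒≱ lt b∈ })) ⟩
        ∑ (allFin n) (λ x → 𝟙 (pool? x)) ∎
      rearrange : ∀ π x → 𝟙 (pool? x) * 𝟙 ((lookup π e ≟ i) ×-dec (pos pool? π x ≤? q)) ≡ 𝟙 (pool? x ×-dec (pos pool? π x ≤? q)) * 𝟙 (lookup π e ≟ i)
      rearrange π x = begin-equality
        𝟙 (pool? x) * 𝟙 ((lookup π e ≟ i) ×-dec (pos pool? π x ≤? q)) ≡⟨ cong (𝟙 (pool? x) *_) (𝟙-× (lookup π e ≟ i) (pos pool? π x ≤? q)) ⟩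
        𝟙 (pool? x) * (𝟙 (lookup π e ≟ i) * 𝟙 (pos pool? π x ≤? q)) ≡⟨ cong (𝟙 (pool? x) *_) (ℕₚ.*-comm (𝟙 (lookup π e ≟ i)) _) ⟩
        𝟙 (pool? x) * (𝟙 (pos pool? π x ≤? q) * 𝟙 (lookup π e ≟ i)) ≡⟨ ℕₚ.*-assoc (𝟙 (pool? x)) _ _ ⟨
        𝟙 (pool? x) * 𝟙 (pos pool? π x ≤? q) * 𝟙 (lookup π e ≟ i) ≡⟨ cong (_* 𝟙 (lookup π e ≟ i)) (𝟙-× (pool? x) (pos pool? π x ≤? q)) ⟨
        𝟙 (pool? x ×-dec (pos pool? π x ≤? q)) * 𝟙 (lookup π e ≟ i) ∎
      below≤atLeast : ∀ π → pos pool? π b ≤ atLeast h π (lookup π b)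
      below≤atLeast π = ∑-mono (allFin n) (λ y _ → 𝟙-mono (pool? y ×-dec (toℕ (lookup π y) <? toℕ (lookup π b))) ((toℕ y <? h) ×-dec (toℕ (lookup π y) ≤? toℕ (lookup π b)))
        (λ { (inj₁ refl , lt) → contradiction lt (ℕₚ.<-irrefl refl) ; (inj₂ y<h , lt) → y<h , ℕₚ.<⇒≤ lt }))
      -- Swapping `b` with a pool member `x` hands the relative rank of `b` over to `x`. Position
      -- `e` keeps its weight, because it lies in `B` and differs from `b`.
      exchange : b ≢ e → ∀ x → Pool x → rare ≤ ∑ (allPerms n) (λ π → 𝟙 ((lookup π e ≟ i) ×-dec (pos pool? π x ≤? q)))
      exchange b≢e x px = ∑-swapV-≤ b x _ _ (λ π _ →
        𝟙-mono ((lookup π e ≟ i) ×-dec (b ∈? rivals π i)) ((lookup (swapV b x π) e ≟ i) ×-dec (pos pool? (swapV b x π) x ≤? q))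
          (λ (πe≡i , b∈U) → trans (swapV-other π (b≢e ∘ sym) (e≢x px)) πe≡i ,
            (begin
              pos pool? (swapV b x π) x                       ≡⟨ cong (λ v → below pool? (swapV b x π) (toℕ v)) (swapV-right b x π) ⟩
              below pool? (swapV b x π) (toℕ (lookup π b))    ≤⟨ below-swap pool? (inj₁ refl) px π (toℕ (lookup π b)) ⟩
              pos pool? π b                                   ≤⟨ below≤atLeast π ⟩
              atLeast h π (lookup π b)                       ≤⟨ proj₂ (proj₂ (∈-⟦⟧⁻ (rival? π i) b∈U)) ⟩
              q ∎)))
        where
        e≢x : Pool x → e ≢ x
        e≢x (inj₁ x≡b) e≡x = b≢e (sym (trans e≡x x≡b))
        e≢x (inj₂ x<h) refl = ℕₚ.<⇒≱ x<h e∈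

      cases : Dec (b ≡ e) → (b∈ : Dec (h ≤ toℕ b)) → suc h * rare ≤ 𝟙 b∈ * (suc q * hits e i)
      cases (yes refl) _ = never (λ π πb≡i r → proj₁ (proj₂ r) πb≡i)
      cases (no _) (no b∉) = never (λ π _ r → b∉ (proj₁ r))
      cases (no b≢e) (yes b∈) = begin
        suc h * rare ≤⟨ ℕₚ.*-monoˡ-≤ rare (size b∈) ⟩
        ∑ (allFin n) (λ x → 𝟙 (pool? x)) * rare ≡⟨ ∑-*ʳ (allFin n) rare _ ⟨
        ∑ (allFin n) (λ x → 𝟙 (pool? x) * rare) ≤⟨ ∑-mono (allFin n) (λ x _ → 𝟙*-mono (pool? x) (exchange b≢e x)) ⟩
        ∑ (allFin n) (λ x → 𝟙 (pool? x) * ∑ (allPerms n) (λ π → 𝟙 ((lookup π e ≟ i) ×-dec (pos pool? π x ≤? q))))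
          ≡⟨ ∑-cong (allFin n) (λ x → sym (∑-*ˡ (allPerms n) (𝟙 (pool? x)) _)) ⟩
        ∑ (allFin n) (λ x → ∑ (allPerms n) (λ π → 𝟙 (pool? x) * 𝟙 ((lookup π e ≟ i) ×-dec (pos pool? π x ≤? q))))
          ≡⟨ ∑-swap (allFin n) (allPerms n) _ ⟩
        ∑ (allPerms n) (λ π → ∑ (allFin n) (λ x → 𝟙 (pool? x) * 𝟙 ((lookup π e ≟ i) ×-dec (pos pool? π x ≤? q))))
          ≡⟨ ∑-cong (allPerms n) (λ π → trans (∑-cong (allFin n) (rearrange π)) (∑-*ʳ (allFin n) _ _)) ⟩
        ∑ (allPerms n) (λ π → ∑ (allFin n) (λ x → 𝟙 (pool? x ×-dec (pos pool? π x ≤? q))) * 𝟙 (lookup π e ≟ i))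
          ≤⟨ ∑-mono (allPerms n) (λ π π∈ → ℕₚ.*-monoˡ-≤ (𝟙 (lookup π e ≟ i)) (count-top pool? π (allPerms-injective π∈) q)) ⟩
        ∑ (allPerms n) (λ π → suc q * 𝟙 (lookup π e ≟ i)) ≡⟨ ∑-*ˡ (allPerms n) (suc q) _ ⟩
        suc q * hits e i       ≡⟨ ℕₚ.*-identityˡ _ ⟨
        1 * (suc q * hits e i) ∎

    late : ℕ
    late = ∑ (allFin n) (λ e → 𝟙 (h ≤? toℕ e))

    -- Given that `e` carries `i`, each late position is a rival with probability at most (q + 1)/(h
    -- + 1), and for either parity of `n` there are at most h + 1 late positions. So the mean number
    -- of rivals is at most q + 1.
    ∑-rivals : h ≤ n → n ≤ suc (h + h) → ∀ {e i} → h ≤ toℕ e →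
      ∑ (allPerms n) (λ π → 𝟙 (lookup π e ≟ i) * ∣ rivals π i ∣) ≤ suc q * hits e i
    ∑-rivals h≤n n≤ {e} {i} e∈ = ℕₚ.*-cancelˡ-≤ (suc h) (begin
      suc h * ∑ (allPerms n) (λ π → 𝟙 (lookup π e ≟ i) * ∣ rivals π i ∣)
        ≡⟨ cong (suc h *_) (∑-cong (allPerms n) (λ π → trans (cong (𝟙 (lookup π e ≟ i) *_) (∣p∣≡∑ (rivals π i)))
             (trans (sym (∑-*ˡ (allFin n) (𝟙 (lookup π e ≟ i)) (λ b → 𝟙 (b ∈? rivals π i)))) (∑-cong (allFin n) (λ b → sym (𝟙-× (lookup π e ≟ i) (b ∈? rivals π i))))))) ⟩
      suc h * ∑ (allPerms n) (λ π → ∑ (allFin n) (λ b → 𝟙 ((lookup π e ≟ i) ×-dec (b ∈? rivals π i))))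
        ≡⟨ cong (suc h *_) (∑-swap (allPerms n) (allFin n) _) ⟩
      suc h * ∑ (allFin n) (λ b → ∑ (allPerms n) (λ π → 𝟙 ((lookup π e ≟ i) ×-dec (b ∈? rivals π i))))
        ≡⟨ ∑-*ˡ (allFin n) (suc h) _ ⟨
      ∑ (allFin n) (λ b → suc h * ∑ (allPerms n) (λ π → 𝟙 ((lookup π e ≟ i) ×-dec (b ∈? rivals π i))))
        ≤⟨ ∑-mono (allFin n) (λ b _ → rival-rare h≤n b e∈) ⟩
      ∑ (allFin n) (λ b → 𝟙 (h ≤? toℕ b) * (suc q * hits e i)) ≡⟨ ∑-*ʳ (allFin n) _ _ ⟩
      late * (suc q * hits e i) ≤⟨ ℕₚ.*-monoˡ-≤ (suc q * hits e i) late≤ ⟩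
      suc h * (suc q * hits e i) ∎)
      where
      open ℕₚ.≤-Reasoning
      late≤ : late ≤ suc h
      late≤ = ℕₚ.+-cancelʳ-≤ h late (suc h) (ℕₚ.≤-trans (ℕₚ.≤-reflexive (count-≥ h≤n)) n≤)

    late≤free+cl : ∀ π i → late ≤ freeCount π i + ∣ cl M (rivals π i) ∣
    late≤free+cl π i = begin
      late ≤⟨ ∑-mono (allFin n) (λ e _ → cover e) ⟩
      ∑ (allFin n) (λ e → 𝟙 (free? π i e) + 𝟙 (e ∈? cl M (rivals π i))) ≡⟨ ∑-+ (allFin n) _ _ ⟩
      freeCount π i + ∑ (allFin n) (λ e → 𝟙 (e ∈? cl M (rivals π i))) ≡⟨ cong (freeCount π i +_) (∣p∣≡∑ (cl M (rivals π i))) ⟨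
      freeCount π i + ∣ cl M (rivals π i) ∣ ∎
      where
      open ℕₚ.≤-Reasoning
      cover : ∀ e → 𝟙 (h ≤? toℕ e) ≤ 𝟙 (free? π i e) + 𝟙 (e ∈? cl M (rivals π i))
      cover e = 𝟙≤ (h ≤? toℕ e) λ e∈ → split (e ∈? cl M (rivals π i)) (free? π i e) (λ e∉ → e∈ , e∉)
        where
        split : ∀ {P Q : Set} (p : Dec P) (q : Dec Q) → (¬ P → Q) → 1 ≤ 𝟙 q + 𝟙 p
        split (yes _) q f = ℕₚ.m≤n+m 1 _
        split (no ¬p) q f = ℕₚ.≤-trans (ℕₚ.≤-reflexive (sym (𝟙-true q (f ¬p)))) (ℕₚ.m≤m+n _ _)

    -- Divided by 2 r N: the carrier of `i` is late and free with probability at least 1/2 - (q +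
    -- 2)/r. In 2 + q, the term q + 1 is the mean number of rivals and 1 comes from `suc ∣ U ∣` in
    -- `∣cl∣-bound`. Position `e` is only a reference point at which `i` is held before being moved.
    good-bound : UniformlyDense M → 0 < rk M → h + h ≤ n → n ≤ suc (h + h) → (e : Fin n) → h ≤ toℕ e → ∀ i →
      rk M * length (allPerms n) ≤ 2 * rk M * goodCount i + 2 * (2 + q) * length (allPerms n)
    good-bound ud 0<r hh≤n n≤ e e∈ i = begin
      r * N                          ≡⟨ cong (r *_) (n*hits e i) ⟨
      r * (n * c)                    ≤⟨ ℕₚ.*-monoʳ-≤ r (ℕₚ.*-monoˡ-≤ c n≤2late) ⟩
      r * ((late + late) * c)        ≡⟨ lem₁ r late c ⟩
      2 * (c * (r * late))           ≤⟨ ℕₚ.*-monoʳ-≤ 2 core ⟩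
      2 * (r * goodCount i + n * (c + suc q * c)) ≡⟨ lem₂ r (goodCount i) n c q ⟩
      2 * r * goodCount i + 2 * (2 + q) * (n * c) ≡⟨ cong (λ k → 2 * r * goodCount i + 2 * (2 + q) * k) (n*hits e i) ⟩
      2 * r * goodCount i + 2 * (2 + q) * N ∎
      where
      open ℕₚ.≤-Reasoning
      r = rk M
      N = length (allPerms n)
      c = hits e i
      h≤n : h ≤ n
      h≤n = ℕₚ.≤-trans (ℕₚ.m≤m+n h h) hh≤n
      n≤2late : n ≤ late + late
      n≤2late = begin
        n        ≡⟨ count-≥ h≤n ⟨
        late + h ≤⟨ ℕₚ.+-monoʳ-≤ late (ℕₚ.+-cancelʳ-≤ h h late (ℕₚ.≤-trans hh≤n (ℕₚ.≤-reflexive (sym (count-≥ h≤n))))) ⟩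
        late + late ∎
      lem₁ : ∀ r b c → r * ((b + b) * c) ≡ 2 * (c * (r * b))
      lem₁ = solve-∀
      lem₂ : ∀ r g n c q → 2 * (r * g + n * (c + suc q * c)) ≡ 2 * r * g + 2 * (2 + q) * (n * c)
      lem₂ = solve-∀
      hit : Vec (Fin n) n → ℕ
      hit π = 𝟙 (lookup π e ≟ i)
      pointwise : ∀ π → hit π * (r * late) ≤ r * (hit π * freeCount π i) + n * (hit π + hit π * ∣ rivals π i ∣)
      pointwise π = begin
        hit π * (r * late) ≤⟨ ℕₚ.*-monoʳ-≤ (hit π) (ℕₚ.*-monoʳ-≤ r (late≤free+cl π i)) ⟩
        hit π * (r * (freeCount π i + ∣ cl M (rivals π i) ∣)) ≡⟨ lem₃ (hit π) r (freeCount π i) ∣ cl M (rivals π i) ∣ ⟩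
        r * (hit π * freeCount π i) + hit π * (∣ cl M (rivals π i) ∣ * r) ≤⟨ ℕₚ.+-monoʳ-≤ (r * (hit π * freeCount π i)) (ℕₚ.*-monoʳ-≤ (hit π) (∣cl∣-bound M ud 0<r (rivals π i))) ⟩
        r * (hit π * freeCount π i) + hit π * (n * suc ∣ rivals π i ∣) ≡⟨ cong (r * (hit π * freeCount π i) +_) (lem₄ (hit π) n ∣ rivals π i ∣) ⟩
        r * (hit π * freeCount π i) + n * (hit π + hit π * ∣ rivals π i ∣) ∎
        where
        lem₃ : ∀ x r f k → x * (r * (f + k)) ≡ r * (x * f) + x * (k * r)
        lem₃ = solve-∀
        lem₄ : ∀ x n u → x * (n * suc u) ≡ n * (x + x * u)
        lem₄ = solve-∀
      core : c * (r * late) ≤ r * goodCount i + n * (c + suc q * c)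
      core = begin
        c * (r * late) ≡⟨ ∑-*ʳ (allPerms n) (r * late) hit ⟨
        ∑ (allPerms n) (λ π → hit π * (r * late)) ≤⟨ ∑-mono (allPerms n) (λ π _ → pointwise π) ⟩
        ∑ (allPerms n) (λ π → r * (hit π * freeCount π i) + n * (hit π + hit π * ∣ rivals π i ∣)) ≡⟨ ∑-+ (allPerms n) _ _ ⟩
        ∑ (allPerms n) (λ π → r * (hit π * freeCount π i)) + ∑ (allPerms n) (λ π → n * (hit π + hit π * ∣ rivals π i ∣))
          ≡⟨ cong₂ _+_ (∑-*ˡ (allPerms n) r _) (trans (∑-*ˡ (allPerms n) n _) (cong (n *_) (∑-+ (allPerms n) hit _))) ⟩
        r * ∑ (allPerms n) (λ π → hit π * freeCount π i) + n * (c + ∑ (allPerms n) (λ π → hit π * ∣ rivals π i ∣))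
          ≤⟨ ℕₚ.+-mono-≤ (ℕₚ.*-monoʳ-≤ r (∑-free≤good e∈)) (ℕₚ.*-monoʳ-≤ n (ℕₚ.+-monoʳ-≤ c (∑-rivals h≤n n≤ e∈))) ⟩
        r * goodCount i + n * (c + suc q * c) ∎

  -- Success of the half-way cutoff

  2xy≤x²+y² : ∀ x y → 2 * (x * y) ≤ x * x + y * y
  2xy≤x²+y² x y with ℕₚ.≤-total x y
  ... | inj₁ x≤y = subst (λ z → 2 * (x * z) ≤ x * x + z * z) (ℕₚ.m+[n∸m]≡n x≤y)
                     (ℕₚ.≤-trans (ℕₚ.m≤m+n _ _) (ℕₚ.≤-reflexive (square x (y ∸ x))))
    where
    square : ∀ x t → 2 * (x * (x + t)) + t * t ≡ x * x + (x + t) * (x + t)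
    square = solve-∀
  ... | inj₂ y≤x = subst (λ z → 2 * (z * y) ≤ z * z + y * y) (ℕₚ.m+[n∸m]≡n y≤x)
                     (ℕₚ.≤-trans (ℕₚ.m≤m+n _ _) (ℕₚ.≤-reflexive (square y (x ∸ y))))
    where
    square : ∀ y t → 2 * ((y + t) * y) + t * t ≡ (y + t) * (y + t) + y * y
    square = solve-∀

  -- The tangent of the convex function j ↦ k / j at j = 3k / 2, which bounds R ≥ (k / j) c from below.
  tangent-bound : ∀ k j c R .{{_ : NonZero k}} → k * c ≤ j * R → 12 * k * c ≤ 9 * k * R + 4 * j * c
  tangent-bound k j c R kc≤jR = begin
    12 * k * c                     ≤⟨ ℕₚ.*-monoˡ-≤ c (ℕₚ.m≤n+m∸n (12 * k) (4 * j)) ⟩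
    (4 * j + d) * c                ≡⟨ ℕₚ.*-distribʳ-+ c (4 * j) d ⟩
    4 * j * c + d * c              ≡⟨ ℕₚ.+-comm (4 * j * c) (d * c) ⟩
    d * c + 4 * j * c              ≤⟨ ℕₚ.+-monoˡ-≤ (4 * j * c) (ℕₚ.*-cancelˡ-≤ k dc) ⟩
    9 * k * R + 4 * j * c          ∎
    where
    open ℕₚ.≤-Reasoning
    -- Beyond j = 3k the tangent is negative; there truncation makes `d` zero.
    d = 12 * k ∸ 4 * j
    -- This is (3k - 2j)² ≥ 0, with equality at the point of tangency.
    dj : d * j ≤ 9 * k * k
    dj = begin
      d * j                        ≡⟨ ℕₚ.*-distribʳ-∸ j (12 * k) (4 * j) ⟩
      12 * k * j ∸ 4 * j * j       ≤⟨ ℕₚ.m≤n+o⇒m∸n≤o _ (4 * j * j) (ℕₚ.≤-trans (ℕₚ.≤-reflexive (lem₁ k j)) (ℕₚ.≤-trans (2xy≤x²+y² (3 * k) (2 * j)) (ℕₚ.≤-reflexive (lem₂ k j)))) ⟩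
      9 * k * k                    ∎
      where
      lem₁ : ∀ k j → 12 * k * j ≡ 2 * (3 * k * (2 * j))
      lem₁ = solve-∀
      lem₂ : ∀ k j → 3 * k * (3 * k) + 2 * j * (2 * j) ≡ 4 * j * j + 9 * k * k
      lem₂ = solve-∀
    dc : k * (d * c) ≤ k * (9 * k * R)
    dc = begin
      k * (d * c)                  ≡⟨ lem₁ k d c ⟩
      d * (k * c)                  ≤⟨ ℕₚ.*-monoʳ-≤ d kc≤jR ⟩
      d * (j * R)                  ≡⟨ ℕₚ.*-assoc d j R ⟨
      d * j * R                    ≤⟨ ℕₚ.*-monoˡ-≤ R dj ⟩
      9 * k * k * R                ≡⟨ lem₂ k R ⟩
      k * (9 * k * R)              ∎
      where
      lem₁ : ∀ k d c → k * (d * c) ≡ d * (k * c)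
      lem₁ = solve-∀
      lem₂ : ∀ k R → 9 * k * k * R ≡ k * (9 * k * R)
      lem₂ = solve-∀

  -- The arithmetic series k + ... + (n - 1), doubled, with every subtraction moved to the other
  -- side.
  ∑-≥ : ∀ n k → k ≤ n → 2 * ∑ (allFin n) (λ b → 𝟙 (k ≤? toℕ b) * toℕ b) + k * k + n ≡ n * n + k
  ∑-≥ zero zero z≤n = refl
  ∑-≥ (suc n) zero z≤n = begin
    2 * ∑ (allFin (suc n)) (λ b → 1 * toℕ b) + 0 + suc n
      ≡⟨ cong (λ s → 2 * s + 0 + suc n) (∑-allFin-suc n (λ b → 1 * toℕ b)) ⟩
    2 * ∑ (allFin n) (λ b → 1 * suc (toℕ b)) + 0 + suc n
      ≡⟨ cong (λ s → 2 * s + 0 + suc n) (trans (∑-cong (allFin n) (λ b → ℕₚ.*-suc 1 (toℕ b))) (trans (∑-+ (allFin n) (λ _ → 1) _) (cong (_+ S) (∑-one-allFin n)))) ⟩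
    2 * (n + S) + 0 + suc n ≡⟨ lem₁ n S ⟩
    (2 * S + 0 + n) + 2 * n + 1 ≡⟨ cong (λ s → s + 2 * n + 1) (∑-≥ n zero z≤n) ⟩
    (n * n + 0) + 2 * n + 1 ≡⟨ lem₂ n ⟩
    suc n * suc n + 0 ∎
    where
    open ≡-Reasoning
    S = ∑ (allFin n) (λ b → 1 * toℕ b)
    lem₁ : ∀ n S → 2 * (n + S) + 0 + suc n ≡ (2 * S + 0 + n) + 2 * n + 1
    lem₁ = solve-∀
    lem₂ : ∀ n → (n * n + 0) + 2 * n + 1 ≡ suc n * suc n + 0
    lem₂ = solve-∀
  ∑-≥ (suc n) (suc k) (s≤s k≤n) = begin
    2 * ∑ (allFin (suc n)) (λ b → 𝟙 (suc k ≤? toℕ b) * toℕ b) + suc k * suc k + suc n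
      ≡⟨ cong (λ s → 2 * s + suc k * suc k + suc n) (∑-allFin-suc n (λ b → 𝟙 (suc k ≤? toℕ b) * toℕ b)) ⟩
    2 * ∑ (allFin n) (λ b → 𝟙 (suc k ≤? suc (toℕ b)) * suc (toℕ b)) + suc k * suc k + suc n
      ≡⟨ cong (λ s → 2 * s + suc k * suc k + suc n) (trans (∑-cong (allFin n) (λ b → trans (ℕₚ.*-suc (𝟙 (suc k ≤? suc (toℕ b))) (toℕ b)) (shift b))) (∑-+ (allFin n) (λ b → 𝟙 (k ≤? toℕ b)) _)) ⟩
    2 * (C + S) + suc k * suc k + suc n ≡⟨ lem₁ C S k n ⟩
    (2 * S + k * k + n) + 2 * (C + k) + 2 ≡⟨ cong₂ (λ s t → s + 2 * t + 2) (∑-≥ n k k≤n) (count-≥ k≤n) ⟩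
    (n * n + k) + 2 * n + 2 ≡⟨ lem₂ n k ⟩
    suc n * suc n + suc k ∎
    where
    open ≡-Reasoning
    S = ∑ (allFin n) (λ b → 𝟙 (k ≤? toℕ b) * toℕ b)
    C = ∑ (allFin n) (λ b → 𝟙 (k ≤? toℕ b))
    shift : ∀ (b : Fin n) → 𝟙 (suc k ≤? suc (toℕ b)) + 𝟙 (suc k ≤? suc (toℕ b)) * toℕ b ≡ 𝟙 (k ≤? toℕ b) + 𝟙 (k ≤? toℕ b) * toℕ b
    shift b = cong (λ x → x + x * toℕ b) (ℕₚ.≤-antisym (𝟙-mono (suc k ≤? suc (toℕ b)) (k ≤? toℕ b) ℕ.s≤s⁻¹) (𝟙-mono (k ≤? toℕ b) (suc k ≤? suc (toℕ b)) s≤s))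
    lem₁ : ∀ C S k n → 2 * (C + S) + suc k * suc k + suc n ≡ (2 * S + k * k + n) + 2 * (C + k) + 2
    lem₁ = solve-∀
    lem₂ : ∀ n k → (n * n + k) + 2 * n + 2 ≡ suc n * suc n + suc k
    lem₂ = solve-∀

  -- Running maxima and the success of a cutoff

  Leads : Vec (Fin n) n → ℕ → Fin n → Set
  Leads π j a = toℕ a < j × (∀ y → toℕ y < j → toℕ (lookup π a) ≤ toℕ (lookup π y))

  leads? : ∀ (π : Vec (Fin n) n) j a → Dec (Leads π j a)
  leads? π j a = (toℕ a <? j) ×-dec Finₚ.all? (λ y → (toℕ y <? j) →-dec (toℕ (lookup π a) ≤? toℕ (lookup π y)))

  leads-unique : ∀ (π : Vec (Fin n) n) → Inj π → ∀ {j} x y → Leads π j x → Leads π j y → x ≡ y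
  leads-unique π inj x y (x< , x≤) (y< , y≤) = inj (Finₚ.toℕ-injective (ℕₚ.≤-antisym (x≤ y y<) (y≤ x x<)))

  leader : ∀ (π : Vec (Fin n) n) j → 0 < j → j ≤ n → ∃ (Leads π j)
  leader {n} π (suc zero) _ 1≤n = fromℕ< 1≤n , ℕₚ.≤-reflexive (cong suc (Finₚ.toℕ-fromℕ< 1≤n)) ,
    λ y y<1 → ℕₚ.≤-reflexive (cong (toℕ ∘ lookup π) (Finₚ.toℕ-injective (trans (Finₚ.toℕ-fromℕ< 1≤n) (sym (ℕₚ.n<1⇒n≡0 y<1)))))
  leader {n} π (suc (suc j)) _ j<n with leader π (suc j) (s≤s z≤n) (ℕₚ.<⇒≤ j<n)
  ... | a , a< , a≤ = choose (ℕₚ.≤-total (toℕ (lookup π a)) (toℕ (lookup π x)))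
    where
    x : Fin n
    x = fromℕ< j<n
    step : ∀ y → toℕ y < suc (suc j) → toℕ y < suc j ⊎ y ≡ x
    step y y< with ℕₚ.m≤n⇒m<n∨m≡n (ℕ.s≤s⁻¹ y<)
    ... | inj₁ lt = inj₁ lt
    ... | inj₂ eq = inj₂ (Finₚ.toℕ-injective (trans eq (sym (Finₚ.toℕ-fromℕ< j<n))))
    choose : toℕ (lookup π a) ≤ toℕ (lookup π x) ⊎ toℕ (lookup π x) ≤ toℕ (lookup π a) → ∃ (Leads π (suc (suc j)))
    choose (inj₁ a≤x) = a , ℕₚ.m≤n⇒m≤1+n a< , λ y y< → case-a y (step y y<)
      where
      case-a : ∀ y → toℕ y < suc j ⊎ y ≡ x → toℕ (lookup π a) ≤ toℕ (lookup π y)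
      case-a y (inj₁ lt)   = a≤ y lt
      case-a y (inj₂ refl) = a≤x
    choose (inj₂ x≤a) = x , ℕₚ.≤-reflexive (cong suc (Finₚ.toℕ-fromℕ< j<n)) , λ y y< → case-x y (step y y<)
      where
      case-x : ∀ y → toℕ y < suc j ⊎ y ≡ x → toℕ (lookup π x) ≤ toℕ (lookup π y)
      case-x y (inj₁ lt)   = ℕₚ.≤-trans x≤a (a≤ y lt)
      case-x y (inj₂ refl) = ℕₚ.≤-refl

  module _ (i : Fin n) where

    leadCount : Fin n → Fin n → ℕ
    leadCount b a = ∑ (allPerms n) (λ π → 𝟙 ((lookup π b ≟ i) ×-dec leads? π (toℕ b) a))

    -- Transposing two positions before `b` permutes the arrivals before `b`: their maximum moves
    -- from `a` to `a′` and the weight at `b` stays. If `a` is not before `b`, it never leads.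
    leadCount-≤ : ∀ b a a′ → toℕ a′ < toℕ b → leadCount b a ≤ 𝟙 (toℕ a <? toℕ b) * leadCount b a′
    leadCount-≤ b a a′ a′<b = cases (toℕ a <? toℕ b)
      where
      cases : (d : Dec (toℕ a < toℕ b)) → leadCount b a ≤ 𝟙 d * leadCount b a′
      cases (no a≮b) = ℕₚ.≤-reflexive (trans (∑-cong (allPerms n) (λ π → 𝟙-false ((lookup π b ≟ i) ×-dec leads? π (toℕ b) a) (a≮b ∘ proj₁ ∘ proj₂))) (∑-zero (allPerms n)))
      cases (yes a<b) = ℕₚ.≤-trans (∑-swapV-≤ a a′ _ _ (λ π _ →
        𝟙-mono ((lookup π b ≟ i) ×-dec leads? π (toℕ b) a) ((lookup (swapV a a′ π) b ≟ i) ×-dec leads? (swapV a a′ π) (toℕ b) a′)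
          (λ (πb≡i , _ , a≤) → trans (swapV-other π (≢b a<b) (≢b a′<b)) πb≡i , a′<b ,
             λ y y<b → subst (λ v → toℕ v ≤ toℕ (lookup (swapV a a′ π) y)) (sym (swapV-right a a′ π))
               (subst (λ v → toℕ (lookup π a) ≤ toℕ v) (sym (lookup-swapV a a′ π y)) (a≤ (transpose a a′ y) (closed y y<b))))))
        (ℕₚ.≤-reflexive (sym (ℕₚ.*-identityˡ _)))
        where
        ≢b : ∀ {x} → toℕ x < toℕ b → b ≢ x
        ≢b lt refl = ℕₚ.<-irrefl refl lt
        closed : ∀ y → toℕ y < toℕ b → toℕ (transpose a a′ y) < toℕ b
        closed y y<b with y ≟ a | y ≟ a′
        ... | yes _ | _     = a′<b
        ... | no _  | yes _ = a<b
        ... | no _  | no _  = y<b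

    -- One of the first `toℕ b` positions holds their maximum, and all of them are equally likely to
    -- do so.
    hits≤leadCount : ∀ b a → toℕ a < toℕ b → hits b i ≤ toℕ b * leadCount b a
    hits≤leadCount b a a<b = begin
      hits b i ≤⟨ ∑-mono (allPerms n) (λ π _ → 𝟙≤ (lookup π b ≟ i) (exists π)) ⟩
      ∑ (allPerms n) (λ π → ∑ (allFin n) (λ x → 𝟙 ((lookup π b ≟ i) ×-dec leads? π (toℕ b) x))) ≡⟨ ∑-swap (allPerms n) (allFin n) _ ⟩
      ∑ (allFin n) (leadCount b) ≤⟨ ∑-mono (allFin n) (λ x _ → leadCount-≤ b x a a<b) ⟩
      ∑ (allFin n) (λ x → 𝟙 (toℕ x <? toℕ b) * leadCount b a) ≡⟨ ∑-*ʳ (allFin n) (leadCount b a) _ ⟩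
      ∑ (allFin n) (λ x → 𝟙 (toℕ x <? toℕ b)) * leadCount b a ≡⟨ cong (_* leadCount b a) (count-< n (toℕ b) (ℕₚ.<⇒≤ (Finₚ.toℕ<n b))) ⟩
      toℕ b * leadCount b a ∎
      where
      open ℕₚ.≤-Reasoning
      exists : ∀ π → lookup π b ≡ i → 1 ≤ ∑ (allFin n) (λ x → 𝟙 ((lookup π b ≟ i) ×-dec leads? π (toℕ b) x))
      exists π πb≡i = let (x , lx) = leader π (toℕ b) (ℕₚ.≤-<-trans z≤n a<b) (ℕₚ.<⇒≤ (Finₚ.toℕ<n b)) in
        ℕₚ.≤-trans (ℕₚ.≤-reflexive (sym (𝟙-true ((lookup π b ≟ i) ×-dec leads? π (toℕ b) x) (πb≡i , lx))))
          (∈⇒≤∑ (λ x → 𝟙 ((lookup π b ≟ i) ×-dec leads? π (toℕ b) x)) (∈-allFin x))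

    module _ (k : ℕ) where

      -- Witness of success when `i` is the maximum: it sits at `b`, and the best earlier arrival
      -- `a` was sampled, so nothing between the sample and `b` can be picked.
      Wins : Vec (Fin n) n → Fin n → Fin n → Set
      Wins π b a = k ≤ toℕ b × toℕ a < k × lookup π b ≡ i × Leads π (toℕ b) a

      wins? : ∀ π b a → Dec (Wins π b a)
      wins? π b a = (k ≤? toℕ b) ×-dec (toℕ a <? k) ×-dec (lookup π b ≟ i) ×-dec leads? π (toℕ b) a

      winCount : ℕ
      winCount = ∑ (allPerms n) (λ π → ∑ (allFin n) (λ b → ∑ (allFin n) (λ a → 𝟙 (wins? π b a))))

      -- `b` is determined by `i`, and `a` by being the leader, so `winCount` counts bijections and
      -- not witnesses.
      wins≤1 : ∀ π → Inj π → ∑ (allFin n) (λ b → ∑ (allFin n) (λ a → 𝟙 (wins? π b a))) ≤ 1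
      wins≤1 π inj = begin
        ∑ (allFin n) (λ b → ∑ (allFin n) (λ a → 𝟙 (wins? π b a))) ≤⟨ ∑-mono (allFin n) (λ b _ → inner b (lookup π b ≟ i)) ⟩
        ∑ (allFin n) (λ b → 𝟙 (lookup π b ≟ i)) ≡⟨ ∑-preimage π inj i ⟩
        1 ∎
        where
        open ℕₚ.≤-Reasoning
        inner : ∀ b (d : Dec (lookup π b ≡ i)) → ∑ (allFin n) (λ a → 𝟙 (wins? π b a)) ≤ 𝟙 d
        inner b (yes _) = ∑-𝟙≤1 (wins? π b) (Uₚ.allFin⁺ n) (λ x y wx wy → leads-unique π inj x y (proj₂ (proj₂ (proj₂ wx))) (proj₂ (proj₂ (proj₂ wy))))
        inner b (no ≢i) = ℕₚ.≤-reflexive (trans (∑-cong (allFin n) (λ a → 𝟙-false (wins? π b a) (≢i ∘ proj₁ ∘ proj₂ ∘ proj₂))) (∑-zero (allFin n)))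

      winsAt : Fin n → ℕ
      winsAt b = ∑ (allFin n) (λ a → 𝟙 (toℕ a <? k) * leadCount b a)

      winCount≡ : winCount ≡ ∑ (allFin n) (λ b → 𝟙 (k ≤? toℕ b) * winsAt b)
      winCount≡ = begin
        winCount ≡⟨ ∑-swap (allPerms n) (allFin n) _ ⟩
        ∑ (allFin n) (λ b → ∑ (allPerms n) (λ π → ∑ (allFin n) (λ a → 𝟙 (wins? π b a))))
          ≡⟨ ∑-cong (allFin n) (λ b → ∑-swap (allPerms n) (allFin n) _) ⟩
        ∑ (allFin n) (λ b → ∑ (allFin n) (λ a → ∑ (allPerms n) (λ π → 𝟙 (wins? π b a))))
          ≡⟨ ∑-cong (allFin n) (λ b → trans (∑-cong (allFin n) (factor b)) (∑-*ˡ (allFin n) (𝟙 (k ≤? toℕ b)) _)) ⟩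
        ∑ (allFin n) (λ b → 𝟙 (k ≤? toℕ b) * winsAt b) ∎
        where
        open ≡-Reasoning
        factor : ∀ b a → ∑ (allPerms n) (λ π → 𝟙 (wins? π b a)) ≡ 𝟙 (k ≤? toℕ b) * (𝟙 (toℕ a <? k) * leadCount b a)
        factor b a = begin
          ∑ (allPerms n) (λ π → 𝟙 (wins? π b a)) ≡⟨ ∑-cong (allPerms n) (λ π → trans (𝟙-× (k ≤? toℕ b) ((toℕ a <? k) ×-dec (lookup π b ≟ i) ×-dec leads? π (toℕ b) a)) (cong (𝟙 (k ≤? toℕ b) *_) (𝟙-× (toℕ a <? k) ((lookup π b ≟ i) ×-dec leads? π (toℕ b) a)))) ⟩
          ∑ (allPerms n) (λ π → 𝟙 (k ≤? toℕ b) * (𝟙 (toℕ a <? k) * 𝟙 ((lookup π b ≟ i) ×-dec leads? π (toℕ b) a))) ≡⟨ ∑-*ˡ (allPerms n) (𝟙 (k ≤? toℕ b)) _ ⟩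
          𝟙 (k ≤? toℕ b) * ∑ (allPerms n) (λ π → 𝟙 (toℕ a <? k) * 𝟙 ((lookup π b ≟ i) ×-dec leads? π (toℕ b) a)) ≡⟨ cong (𝟙 (k ≤? toℕ b) *_) (∑-*ˡ (allPerms n) (𝟙 (toℕ a <? k)) _) ⟩
          𝟙 (k ≤? toℕ b) * (𝟙 (toℕ a <? k) * leadCount b a) ∎

      -- The conditional probability k/j: each of the `k` sampled positions leads with a share of at
      -- least 1/j, where j = `toℕ b`.
      winsAt-bound : ∀ b → k ≤ toℕ b → k * hits b i ≤ toℕ b * winsAt b
      winsAt-bound b k≤b = begin
        k * hits b i ≡⟨ cong (_* hits b i) (count-< n k (ℕₚ.≤-trans k≤b (ℕₚ.<⇒≤ (Finₚ.toℕ<n b)))) ⟨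
        ∑ (allFin n) (λ a → 𝟙 (toℕ a <? k)) * hits b i ≡⟨ ∑-*ʳ (allFin n) (hits b i) _ ⟨
        ∑ (allFin n) (λ a → 𝟙 (toℕ a <? k) * hits b i) ≤⟨ ∑-mono (allFin n) (λ a _ → 𝟙*-mono (toℕ a <? k) (λ a<k → hits≤leadCount b a (ℕₚ.<-≤-trans a<k k≤b))) ⟩
        ∑ (allFin n) (λ a → 𝟙 (toℕ a <? k) * (toℕ b * leadCount b a)) ≡⟨ ∑-cong (allFin n) (λ a → lem (𝟙 (toℕ a <? k)) (toℕ b) (leadCount b a)) ⟩
        ∑ (allFin n) (λ a → toℕ b * (𝟙 (toℕ a <? k) * leadCount b a)) ≡⟨ ∑-*ˡ (allFin n) (toℕ b) _ ⟩
        toℕ b * winsAt b ∎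
        where
        open ℕₚ.≤-Reasoning
        lem : ∀ x y z → x * (y * z) ≡ y * (x * z)
        lem = solve-∀

      -- `tangent-bound` summed over the positions from `k` on; being linear in the position, its
      -- right side is evaluated in closed form by `∑-≥`.
      winCount-bound : .{{_ : NonZero k}} → k ≤ n → (e : Fin n) → let c = hits e i; C = ∑ (allFin n) (λ b → 𝟙 (k ≤? toℕ b)) in
        C * (12 * k * c) + 2 * (k * k + n) * c ≤ 9 * k * winCount + 2 * (n * n + k) * c
      winCount-bound k≤n e = begin
        C * (12 * k * c) + 2 * (k * k + n) * c ≤⟨ ℕₚ.+-monoˡ-≤ (2 * (k * k + n) * c) summed ⟩
        9 * k * winCount + 4 * c * S + 2 * (k * k + n) * c ≡⟨ lem₁ (9 * k * winCount) c S k n ⟩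
        9 * k * winCount + 2 * (2 * S + k * k + n) * c ≡⟨ cong (λ s → 9 * k * winCount + 2 * s * c) (∑-≥ n k k≤n) ⟩
        9 * k * winCount + 2 * (n * n + k) * c ∎
        where
        open ℕₚ.≤-Reasoning
        c = hits e i
        C = ∑ (allFin n) (λ b → 𝟙 (k ≤? toℕ b))
        S = ∑ (allFin n) (λ b → 𝟙 (k ≤? toℕ b) * toℕ b)
        lem₁ : ∀ x c S k n → x + 4 * c * S + 2 * (k * k + n) * c ≡ x + 2 * (2 * S + k * k + n) * c
        lem₁ = solve-∀
        lem₂ : ∀ x k R j c → x * (9 * k * R + 4 * j * c) ≡ 9 * k * (x * R) + 4 * c * (x * j)
        lem₂ = solve-∀
        term : ∀ b → k ≤ toℕ b → 12 * k * c ≤ 9 * k * winsAt b + 4 * toℕ b * c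
        term b k≤b = tangent-bound k (toℕ b) c (winsAt b) (ℕₚ.≤-trans (ℕₚ.*-monoʳ-≤ k (hits-≤ e b i)) (winsAt-bound b k≤b))
        summed : C * (12 * k * c) ≤ 9 * k * winCount + 4 * c * S
        summed = begin
          C * (12 * k * c) ≡⟨ ∑-*ʳ (allFin n) (12 * k * c) _ ⟨
          ∑ (allFin n) (λ b → 𝟙 (k ≤? toℕ b) * (12 * k * c)) ≤⟨ ∑-mono (allFin n) (λ b _ → 𝟙*-mono (k ≤? toℕ b) (term b)) ⟩
          ∑ (allFin n) (λ b → 𝟙 (k ≤? toℕ b) * (9 * k * winsAt b + 4 * toℕ b * c)) ≡⟨ ∑-cong (allFin n) (λ b → lem₂ (𝟙 (k ≤? toℕ b)) k (winsAt b) (toℕ b) c) ⟩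
          ∑ (allFin n) (λ b → 9 * k * (𝟙 (k ≤? toℕ b) * winsAt b) + 4 * c * (𝟙 (k ≤? toℕ b) * toℕ b)) ≡⟨ ∑-+ (allFin n) _ _ ⟩
          ∑ (allFin n) (λ b → 9 * k * (𝟙 (k ≤? toℕ b) * winsAt b)) + ∑ (allFin n) (λ b → 4 * c * (𝟙 (k ≤? toℕ b) * toℕ b))
            ≡⟨ cong₂ _+_ (∑-*ˡ (allFin n) (9 * k) _) (∑-*ˡ (allFin n) (4 * c) _) ⟩
          9 * k * ∑ (allFin n) (λ b → 𝟙 (k ≤? toℕ b) * winsAt b) + 4 * c * S ≡⟨ cong (λ s → 9 * k * s + 4 * c * S) winCount≡ ⟨
          9 * k * winCount + 4 * c * S ∎

      -- For either parity `winCount-bound` gives a success probability of at least 1/3. The terms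
      -- with `42 * k * k * c` in `even` and `odd` are the surplus over 11/40, after multiplication
      -- by 9k · 40.
      halfway-wins : .{{_ : NonZero k}} → n ≡ k + k ⊎ n ≡ suc (k + k) → (e : Fin n) → 11 * length (allPerms n) ≤ 40 * winCount
      halfway-wins half e = subst (λ N → 11 * N ≤ 40 * winCount) (n*hits e i)
        (ℕₚ.*-cancelˡ-≤ (9 * k) {{ℕₚ.m*n≢0 9 k}} (scaled half))
        where
        open ℕₚ.≤-Reasoning
        c = hits e i
        C = ∑ (allFin n) (λ b → 𝟙 (k ≤? toℕ b))
        k≤n : n ≡ k + k ⊎ n ≡ suc (k + k) → k ≤ n
        k≤n (inj₁ eq) = subst (k ≤_) (sym eq) (ℕₚ.m≤m+n k k)
        k≤n (inj₂ eq) = subst (k ≤_) (sym eq) (ℕₚ.m≤n⇒m≤1+n (ℕₚ.m≤m+n k k))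
        even : ∀ k c → 40 * (k * (12 * k * c) + 2 * (k * k + (k + k)) * c) ≡
                       (9 * k * (11 * ((k + k) * c)) + (42 * k * k * c + 80 * k * c)) + 40 * (2 * ((k + k) * (k + k) + k) * c)
        even = solve-∀
        odd : ∀ k c → 40 * (suc k * (12 * k * c) + 2 * (k * k + suc (k + k)) * c) ≡
                      (9 * k * (11 * (suc (k + k) * c)) + (42 * k * k * c + 141 * k * c)) + 40 * (2 * (suc (k + k) * suc (k + k) + k) * c)
        odd = solve-∀
        scale : ∀ k W x → 40 * (9 * k * W + x) ≡ 9 * k * (40 * W) + 40 * x
        scale = solve-∀
        finish : ∀ {m x y z} → m + x + z ≤ y + z → m ≤ y
        finish {m} {x} {y} {z} le = ℕₚ.≤-trans (ℕₚ.m≤m+n m x) (ℕₚ.+-cancelʳ-≤ z (m + x) y le)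
        scaled : n ≡ k + k ⊎ n ≡ suc (k + k) → 9 * k * (11 * (n * c)) ≤ 9 * k * (40 * winCount)
        scaled d@(inj₁ eq) = subst (λ m → 9 * k * (11 * (m * c)) ≤ 9 * k * (40 * winCount)) (sym eq) (finish (begin
          9 * k * (11 * ((k + k) * c)) + (42 * k * k * c + 80 * k * c) + 40 * (2 * ((k + k) * (k + k) + k) * c) ≡⟨ even k c ⟨
          40 * (k * (12 * k * c) + 2 * (k * k + (k + k)) * c) ≤⟨ ℕₚ.*-monoʳ-≤ 40 bound ⟩
          40 * (9 * k * winCount + 2 * ((k + k) * (k + k) + k) * c) ≡⟨ scale k winCount _ ⟩
          9 * k * (40 * winCount) + 40 * (2 * ((k + k) * (k + k) + k) * c) ∎))
          where
          C≡k : C ≡ k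
          C≡k = ℕₚ.+-cancelʳ-≡ k C k (trans (count-≥ (k≤n d)) eq)
          bound : k * (12 * k * c) + 2 * (k * k + (k + k)) * c ≤ 9 * k * winCount + 2 * ((k + k) * (k + k) + k) * c
          bound = subst (λ m → k * (12 * k * c) + 2 * (k * k + m) * c ≤ 9 * k * winCount + 2 * (m * m + k) * c) eq
            (subst (λ C → C * (12 * k * c) + 2 * (k * k + n) * c ≤ 9 * k * winCount + 2 * (n * n + k) * c) C≡k (winCount-bound (k≤n d) e))
        scaled d@(inj₂ eq) = subst (λ m → 9 * k * (11 * (m * c)) ≤ 9 * k * (40 * winCount)) (sym eq) (finish (begin
          9 * k * (11 * (suc (k + k) * c)) + (42 * k * k * c + 141 * k * c) + 40 * (2 * (suc (k + k) * suc (k + k) + k) * c) ≡⟨ odd k c ⟨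
          40 * (suc k * (12 * k * c) + 2 * (k * k + suc (k + k)) * c) ≤⟨ ℕₚ.*-monoʳ-≤ 40 bound ⟩
          40 * (9 * k * winCount + 2 * (suc (k + k) * suc (k + k) + k) * c) ≡⟨ scale k winCount _ ⟩
          9 * k * (40 * winCount) + 40 * (2 * (suc (k + k) * suc (k + k) + k) * c) ∎))
          where
          C≡k : C ≡ suc k
          C≡k = ℕₚ.+-cancelʳ-≡ k C (suc k) (trans (count-≥ (k≤n d)) eq)
          bound : suc k * (12 * k * c) + 2 * (k * k + suc (k + k)) * c ≤ 9 * k * winCount + 2 * (suc (k + k) * suc (k + k) + k) * c
          bound = subst (λ m → suc k * (12 * k * c) + 2 * (k * k + m) * c ≤ 9 * k * winCount + 2 * (m * m + k) * c) eq
            (subst (λ C → C * (12 * k * c) + 2 * (k * k + n) * c ≤ 9 * k * winCount + 2 * (n * n + k) * c) C≡k (winCount-bound (k≤n d) e))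

  -- The algorithms in terms of positions

  ≤⇒≯ : ∀ {x y : ℚ} → x ℚ.≤ y → ¬ y ℚ.< x
  ≤⇒≯ x≤y y<x = ℚₚ.<-irrefl refl (ℚₚ.≤-<-trans x≤y y<x)

  ⌊⌋-true : ∀ {P : Set} (p : Dec P) → P → ⌊ p ⌋ ≡ true
  ⌊⌋-true (yes _) p = refl
  ⌊⌋-true (no ¬p) p = contradiction p ¬p

  ⌊⌋-false : ∀ {P : Set} (p : Dec P) → ¬ P → ⌊ p ⌋ ≡ false
  ⌊⌋-false (yes p) ¬p = contradiction p ¬p
  ⌊⌋-false (no _)  _  = refl

  ⌊⌋-sound : ∀ {P : Set} (p : Dec P) → ⌊ p ⌋ ≡ true → P
  ⌊⌋-sound (yes p) _ = p

  weightsInOrder≡tabulate : (w : Fin n → ℚ) (π : Vec (Fin n) n) → weightsInOrder w π ≡ tabulate (w ∘ lookup π)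
  weightsInOrder≡tabulate w π = Lₚ.map-tabulate (λ e → e) (w ∘ lookup π)

  beats-maxM : ∀ xs {x} → (∀ {y} → y ∈ xs → y ℚ.< x) → beats (maxM xs) x ≡ true
  beats-maxM []       h = refl
  beats-maxM (y ∷ ys) {x} h with maxM ys | beats-maxM ys {x} (h ∘ there)
  ... | nothing | _ = ⌊⌋-true (y ℚₚ.<? x) (h (here refl))
  ... | just m  | m<x with ⌊ y ℚₚ.<? m ⌋
  ...   | true  = m<x
  ...   | false = ⌊⌋-true (y ℚₚ.<? x) (h (here refl))

  loses-maxM : ∀ xs {x y} → y ∈ xs → x ℚ.≤ y → beats (maxM xs) x ≡ false
  loses-maxM (y ∷ ys) {x} (here refl) x≤y with maxM ys
  ... | nothing = ⌊⌋-false (y ℚₚ.<? x) (≤⇒≯ x≤y)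
  ... | just m with y ℚₚ.<? m
  ...   | yes y<m = ⌊⌋-false (m ℚₚ.<? x) (≤⇒≯ (ℚₚ.≤-trans x≤y (ℚₚ.<⇒≤ y<m)))
  ...   | no _    = ⌊⌋-false (y ℚₚ.<? x) (≤⇒≯ x≤y)
  loses-maxM (z ∷ ys) {x} (there y∈) x≤y with maxM ys | loses-maxM ys y∈ x≤y
  ... | just m | lost with z ℚₚ.<? m
  ...   | yes _   = lost
  ...   | no z≮m  = ⌊⌋-false (z ℚₚ.<? x) (≤⇒≯ (ℚₚ.≤-trans x≤m (ℚₚ.≮⇒≥ z≮m)))
    where
    x≤m : x ℚ.≤ m
    x≤m = ℚₚ.≮⇒≥ (λ m<x → contradiction (trans (sym (⌊⌋-true (m ℚₚ.<? x) m<x)) lost) (λ ()))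

  ∈-take-tabulate⁺ : ∀ k (f : Fin n → ℚ) a → toℕ a < k → f a ∈ take k (tabulate f)
  ∈-take-tabulate⁺ (suc k) f fzero    _         = here refl
  ∈-take-tabulate⁺ (suc k) f (fsuc a) (s≤s a<k) = there (∈-take-tabulate⁺ k (f ∘ fsuc) a a<k)

  ∈-take-tabulate⁻ : ∀ k (f : Fin n → ℚ) {y} → y ∈ take k (tabulate f) → ∃ λ a → toℕ a < k × y ≡ f a
  ∈-take-tabulate⁻ {suc n} (suc k) f (here refl) = fzero , s≤s z≤n , refl
  ∈-take-tabulate⁻ {suc n} (suc k) f (there y∈) with ∈-take-tabulate⁻ k (f ∘ fsuc) y∈
  ... | a , a<k , eq = fsuc a , s≤s a<k , eq

  ∑-take-tabulate : ∀ k (f : Fin n → ℚ) (g : ℚ → ℕ) →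
                    ∑ (take k (tabulate f)) g ≡ ∑ (allFin n) (λ a → 𝟙 (toℕ a <? k) * g (f a))
  ∑-take-tabulate {n}     zero    f g = sym (∑-zero (allFin n))
  ∑-take-tabulate {zero}  (suc k) f g = refl
  ∑-take-tabulate {suc n} (suc k) f g = begin
    g (f fzero) + ∑ (take k (tabulate (f ∘ fsuc))) g
      ≡⟨ cong₂ _+_ (sym (ℕₚ.*-identityˡ _)) (∑-take-tabulate k (f ∘ fsuc) g) ⟩
    1 * g (f fzero) + ∑ (allFin n) (λ a → 𝟙 (toℕ a <? k) * g (f (fsuc a)))
      ≡⟨ ∑-allFin-suc n (λ a → 𝟙 (toℕ a <? suc k) * g (f a)) ⟨
    ∑ (allFin (suc n)) (λ a → 𝟙 (toℕ a <? suc k) * g (f a)) ∎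
    where open ≡-Reasoning

  firstBeating-tabulate : ∀ t k (f : Fin n → ℚ) b → k ≤ toℕ b →
    (∀ y → k ≤ toℕ y → toℕ y < toℕ b → beats t (f y) ≡ false) → beats t (f b) ≡ true →
    firstBeating t (drop k (tabulate f)) ≡ f b
  firstBeating-tabulate t zero f fzero _ _ wins = cong (λ c → if c then f fzero else firstBeating t (tabulate (f ∘ fsuc))) wins
  firstBeating-tabulate t zero f (fsuc b) _ loses wins = trans
    (cong (λ c → if c then f fzero else firstBeating t (tabulate (f ∘ fsuc))) (loses fzero z≤n (s≤s z≤n)))
    (firstBeating-tabulate t zero (f ∘ fsuc) b z≤n (λ y _ y<b → loses (fsuc y) z≤n (s≤s y<b)) wins)
  firstBeating-tabulate t (suc k) f (fsuc b) (s≤s k≤b) loses wins =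
    firstBeating-tabulate t k (f ∘ fsuc) b k≤b (λ y k≤y y<b → loses (fsuc y) (s≤s k≤y) (s≤s y<b)) wins

  StrictlyDecreasing : (Fin n → ℚ) → Set
  StrictlyDecreasing w = ∀ i j → toℕ i < toℕ j → w j ℚ.< w i

  decreasing : {w : Fin n → ℚ} → StrictlyDecreasing w → ∀ {i j} → toℕ i ≤ toℕ j → w j ℚ.≤ w i
  decreasing {w = w} dec {i} {j} i≤j with ℕₚ.m≤n⇒m<n∨m≡n i≤j
  ... | inj₁ i<j = ℚₚ.<⇒≤ (dec i j i<j)
  ... | inj₂ i≡j = ℚₚ.≤-reflexive (cong w (sym (Finₚ.toℕ-injective i≡j)))

  decreasing⁻ : {w : Fin n → ℚ} → StrictlyDecreasing w → ∀ {i j} → w j ℚ.≤ w i → toℕ i ≤ toℕ j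
  decreasing⁻ dec {i} {j} le = ℕₚ.≮⇒≥ (λ j<i → ≤⇒≯ le (dec j i j<i))

  module _ (w : Fin (suc n) → ℚ) (dec : StrictlyDecreasing w) where

    -- Arrivals between the sample and `b` lose to the sampled leader `a`. Sampled positions differ
    -- from `b`, so by injectivity their indices are nonzero and `b` beats them all.
    wins⇒selects-max : ∀ k π → Inj π → ∀ b a → Wins fzero k π b a →
                       secretaryCutoff k (weightsInOrder w π) ≡ w fzero
    wins⇒selects-max k π inj b a (k≤b , a<k , πb≡0 , (_ , a≤)) rewrite weightsInOrder≡tabulate w π = trans
      (firstBeating-tabulate (maxM (take k (tabulate (w ∘ lookup π)))) k (w ∘ lookup π) b k≤b
        (λ y k≤y y<b → loses-maxM (take k (tabulate (w ∘ lookup π))) (∈-take-tabulate⁺ k (w ∘ lookup π) a a<k) (decreasing dec (a≤ y y<b)))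
        (beats-maxM (take k (tabulate (w ∘ lookup π))) smaller))
      (cong w πb≡0)
      where
      smaller : ∀ {y} → y ∈ take k (tabulate (w ∘ lookup π)) → y ℚ.< w (lookup π b)
      smaller y∈ with ∈-take-tabulate⁻ k (w ∘ lookup π) y∈
      ... | x , x<k , refl = dec (lookup π b) (lookup π x) (subst (λ z → toℕ z < toℕ (lookup π x)) (sym πb≡0)
        (ℕₚ.n≢0⇒n>0 (λ πx≡0 → ℕₚ.<⇒≱ x<k (subst (λ z → k ≤ toℕ z) (inj (trans πb≡0 (sym (Finₚ.toℕ-injective πx≡0)))) k≤b))))

    winCount≤successCount : ∀ k → winCount {suc n} fzero k ≤ successCount w fzero k
    winCount≤successCount k = ℕₚ.≤-trans
      (∑-mono (allPerms (suc n)) (λ π π∈ → pointwise π (allPerms-injective π∈) (secretaryCutoff k (weightsInOrder w π) ℚ.≟ w fzero)))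
      (ℕₚ.≤-reflexive (sym (length-filter (λ π → secretaryCutoff k (weightsInOrder w π) ℚ.≟ w fzero) (allPerms (suc n)))))
      where
      pointwise : ∀ π → Inj π → (d : Dec (secretaryCutoff k (weightsInOrder w π) ≡ w fzero)) →
                  ∑ (allFin (suc n)) (λ b → ∑ (allFin (suc n)) (λ a → 𝟙 (wins? fzero k π b a))) ≤ 𝟙 d
      pointwise π inj (yes _) = wins≤1 fzero k π inj
      pointwise π inj (no ¬s) = ℕₚ.≤-reflexive (trans
        (∑-cong (allFin (suc n)) (λ b → trans (∑-cong (allFin (suc n)) (λ a → 𝟙-false (wins? fzero k π b a) (¬s ∘ wins⇒selects-max k π inj b a)))
          (∑-zero (allFin (suc n)))))
        (∑-zero (allFin (suc n))))

  -- Maximality of the optimal cutoff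

  argmax : (ℕ → ℕ) → List ℕ → ℕ → ℕ → ℕ
  argmax s []       best m = best
  argmax s (k ∷ ks) best m = if ⌊ m <? s k ⌋ then argmax s ks k (s k) else argmax s ks best m

  -- Two recursion equations determine the function; the loop local to `optCutoff` satisfies both by
  -- computation.
  argmax-unique : (s : ℕ → ℕ) (g : List ℕ → ℕ → ℕ → ℕ) → (∀ b m → g [] b m ≡ b) →
    (∀ k ks b m → g (k ∷ ks) b m ≡ (if ⌊ m <? s k ⌋ then g ks k (s k) else g ks b m)) →
    ∀ ks b m → g ks b m ≡ argmax s ks b m
  argmax-unique s g p q []       b m = p b m
  argmax-unique s g p q (k ∷ ks) b m with ⌊ m <? s k ⌋ | q k ks b m
  ... | true  | eq = trans eq (argmax-unique s g p q ks _ _)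
  ... | false | eq = trans eq (argmax-unique s g p q ks _ _)

  -- The loop inside optCutoff has no name outside of it; once its arguments are abstracted to variables,
  -- unification instantiates g in argmax-unique with it.
  optCutoff≡argmax : ∀ (w : Fin n → ℚ) top → optCutoff w top ≡ argmax (successCount w top) (upTo (suc n)) 0 0
  optCutoff≡argmax {n} w top
    -- `upTo (suc n)` starts with cutoff 0. Splitting on the count at 0 resolves that first round,
    -- and in both branches the loop continues on the remaining cutoffs `ks`.
    with argmax-unique (successCount w top) _ (λ _ _ → refl) (λ _ _ _ _ → refl) | applyUpTo suc n | successCount w top 0
  ... | loop≡ | ks | zero  = loop≡ ks 0 0
  ... | loop≡ | ks | suc c with 0 | suc c
  ...   | best | m = loop≡ ks best m

  -- The invariant is an inequality because the loop starts with record 0 for cutoff 0, whose true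
  -- score may be larger.
  argmax-max : ∀ (s : ℕ → ℕ) ks best m → m ≤ s best →
               m ≤ s (argmax s ks best m) × (∀ {k} → k ∈ ks → s k ≤ s (argmax s ks best m))
  argmax-max s []       best m m≤ = m≤ , λ ()
  argmax-max s (x ∷ ks) best m m≤ with m <? s x
  ... | yes m<sx = let (p , q) = argmax-max s ks x (s x) ℕₚ.≤-refl in
                   ℕₚ.≤-trans (ℕₚ.<⇒≤ m<sx) p , λ { (here refl) → p ; (there k∈) → q k∈ }
  ... | no m≮sx  = let (p , q) = argmax-max s ks best m m≤ in
                   p , λ { (here refl) → ℕₚ.≤-trans (ℕₚ.≮⇒≥ m≮sx) p ; (there k∈) → q k∈ }

  -- Transfers a lower bound for any single cutoff, here half of the input, to the optimal rule.
  optCutoff-max : ∀ (w : Fin n → ℚ) top k → k ≤ n → successCount w top k ≤ successCount w top (optCutoff w top)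
  optCutoff-max {n} w top k k≤n rewrite optCutoff≡argmax w top =
    proj₂ (argmax-max (successCount w top) (upTo (suc n)) 0 0 z≤n) (∈-upTo⁺ (s≤s k≤n))

  -- The threshold as a count of sampled weights

  AllPairs-reverse : ∀ {A : Set} {R : A → A → Set} {xs} → AllPairs R xs → AllPairs (λ x y → R y x) (reverse xs)
  AllPairs-reverse [] = []
  AllPairs-reverse {R = R} {x ∷ xs} (Rx ∷ Rxs) rewrite Lₚ.unfold-reverse x xs =
    AllPairsₚ.++⁺ (AllPairs-reverse Rxs) ([] ∷ []) (All.map (λ Rxy → Rxy ∷ []) (All-resp-↭ (↭-sym (↭-reverse xs)) Rx))

  -- In a descending list the entries that are at least `x` form an initial segment, so `x` beats
  -- entry `q`, counted from 0, exactly when the segment has length at most `q`. If there is no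
  -- entry `q`, both sides hold, since `beats nothing` is true.
  descending-beats : ∀ q {ds} x → AllPairs ℚ._≥_ ds →
    (beats (L.head (drop q ds)) x ≡ true → ∑ ds (λ d → 𝟙 (x ℚ.≤? d)) ≤ q) ×
    (∑ ds (λ d → 𝟙 (x ℚ.≤? d)) ≤ q → beats (L.head (drop q ds)) x ≡ true)
  descending-beats zero    {[]} x _ = (λ _ → z≤n) , (λ _ → refl)
  descending-beats (suc q) {[]} x _ = (λ _ → z≤n) , (λ _ → refl)
  descending-beats zero {d ∷ ds} x (d≥ ∷ _) =
    (λ b → ℕₚ.≤-reflexive (trans (∑-∈-cong (d ∷ ds) (λ y y∈ → 𝟙-false (x ℚ.≤? y) (λ x≤y → ≤⇒≯ x≤y (ℚₚ.≤-<-trans (top y∈) (⌊⌋-sound (d ℚₚ.<? x) b)))))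
                                  (∑-zero (d ∷ ds)))) ,
    (λ none → ⌊⌋-true (d ℚₚ.<? x) (ℚₚ.≰⇒> (λ x≤d → ℕₚ.<⇒≱ (ℕₚ.≤-reflexive (sym (𝟙-true (x ℚ.≤? d) x≤d))) (ℕₚ.m+n≤o⇒m≤o (𝟙 (x ℚ.≤? d)) none))))
    where
    top : ∀ {y} → y ∈ d ∷ ds → y ℚ.≤ d
    top (here refl) = ℚₚ.≤-refl
    top (there y∈)  = All.lookup d≥ y∈
  descending-beats (suc q) {d ∷ ds} x (d≥ ∷ sorted) = step (x ℚ.≤? d) (descending-beats q x sorted)
    where
    Tail = ∑ ds (λ d → 𝟙 (x ℚ.≤? d))
    step : (c : Dec (x ℚ.≤ d)) →
      (beats (L.head (drop q ds)) x ≡ true → Tail ≤ q) × (Tail ≤ q → beats (L.head (drop q ds)) x ≡ true) →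
      (beats (L.head (drop q ds)) x ≡ true → 𝟙 c + Tail ≤ suc q) × (𝟙 c + Tail ≤ suc q → beats (L.head (drop q ds)) x ≡ true)
    step (yes _)  (to , from) = s≤s ∘ to , from ∘ ℕ.s≤s⁻¹
    step (no x≰d) (to , from) = (λ _ → ℕₚ.≤-trans none z≤n) , (λ _ → from (ℕₚ.≤-trans none z≤n))
      where
      none : Tail ≤ 0
      none = ℕₚ.≤-reflexive (trans (∑-∈-cong ds (λ y y∈ → 𝟙-false (x ℚ.≤? y) (λ x≤y → x≰d (ℚₚ.≤-trans x≤y (All.lookup d≥ y∈))))) (∑-zero ds))

  nthLargest-beats : ∀ q xs x →
    (beats (nthLargest q xs) x ≡ true → ∑ xs (λ d → 𝟙 (x ℚ.≤? d)) ≤ q) ×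
    (∑ xs (λ d → 𝟙 (x ℚ.≤? d)) ≤ q → beats (nthLargest q xs) x ≡ true)
  nthLargest-beats q xs x = subst (λ s → (beats (nthLargest q xs) x ≡ true → s ≤ q) × (s ≤ q → beats (nthLargest q xs) x ≡ true))
    (∑-↭ _ (↭-trans (↭-reverse (sort xs)) (sort-↭ xs)))
    (descending-beats q x (AllPairs-reverse (Sortedₚ.Sorted⇒AllPairs (DecTotalOrder.totalOrder ℚₚ.≤-decTotalOrder) (sort-↗ xs))))

  threshold : (Fin n → ℚ) → ℕ → ℕ → Vec (Fin n) n → Maybe ℚ
  threshold w h q π = nthLargest q (take h (weightsInOrder w π))

  module _ (w : Fin n → ℚ) (dec : StrictlyDecreasing w) (h q : ℕ) (π : Vec (Fin n) n) where

    -- Strict monotonicity of `w` turns comparisons of weights into reversed comparisons of indices.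
    count≡atLeast : ∀ v → ∑ (take h (weightsInOrder w π)) (λ d → 𝟙 (w v ℚ.≤? d)) ≡ atLeast h π v
    count≡atLeast v = begin
      ∑ (take h (weightsInOrder w π)) (λ d → 𝟙 (w v ℚ.≤? d)) ≡⟨ cong (λ xs → ∑ (take h xs) (λ d → 𝟙 (w v ℚ.≤? d))) (weightsInOrder≡tabulate w π) ⟩
      ∑ (take h (tabulate (w ∘ lookup π))) (λ d → 𝟙 (w v ℚ.≤? d)) ≡⟨ ∑-take-tabulate h (w ∘ lookup π) _ ⟩
      ∑ (allFin n) (λ a → 𝟙 (toℕ a <? h) * 𝟙 (w v ℚ.≤? w (lookup π a)))
        ≡⟨ ∑-cong (allFin n) (λ a → trans (cong (𝟙 (toℕ a <? h) *_) (same a)) (sym (𝟙-× (toℕ a <? h) (toℕ (lookup π a) ≤? toℕ v)))) ⟩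
      atLeast h π v ∎
      where
      open ≡-Reasoning
      same : ∀ a → 𝟙 (w v ℚ.≤? w (lookup π a)) ≡ 𝟙 (toℕ (lookup π a) ≤? toℕ v)
      same a = ℕₚ.≤-antisym (𝟙-mono (w v ℚ.≤? w (lookup π a)) (toℕ (lookup π a) ≤? toℕ v) (decreasing⁻ dec))
                            (𝟙-mono (toℕ (lookup π a) ≤? toℕ v) (w v ℚ.≤? w (lookup π a)) (decreasing dec))

    beats⇒atLeast : ∀ v → beats (threshold w h q π) (w v) ≡ true → atLeast h π v ≤ q
    beats⇒atLeast v b = subst (_≤ q) (count≡atLeast v) (proj₁ (nthLargest-beats q _ (w v)) b)

    atLeast⇒beats : ∀ v → atLeast h π v ≤ q → beats (threshold w h q π) (w v) ≡ true
    atLeast⇒beats v le = proj₂ (nthLargest-beats q _ (w v)) (subst (_≤ q) (sym (count≡atLeast v)) le)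

  -- Weighted sums and the value of the greedy phase

  -- Rational division normalises by a gcd. Keeping `ι` opaque prevents its unfolding; `ι-def`
  -- restores the literal fraction where the statement needs it.
  abstract
    ι : ℕ → ℚ
    ι m = ℤ.+ m ℚ./ 1

    ι-toℚᵘ : ∀ m → ℚ.toℚᵘ (ι m) ℚᵘ.≃ ℚᵘ.mkℚᵘ (ℤ.+ m) 0
    ι-toℚᵘ m = ℚₚ.toℚᵘ-fromℚᵘ (ℚᵘ.mkℚᵘ (ℤ.+ m) 0)

    ι-+ : ∀ a b → ι (a + b) ≡ ι a ℚ.+ ι b
    ι-+ a b = ℚₚ.toℚᵘ-injective (ℚᵘₚ.≃-trans (ι-toℚᵘ (a + b)) (ℚᵘₚ.≃-trans (ℚᵘ.*≡* (cong (ℤ._* ℤ.+ 1) core))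
      (ℚᵘₚ.≃-sym (ℚᵘₚ.≃-trans (ℚₚ.toℚᵘ-homo-+ (ι a) (ι b)) (ℚᵘₚ.+-cong (ι-toℚᵘ a) (ι-toℚᵘ b))))))
      where
      core : ℤ.+ (a + b) ≡ ℤ.+ a ℤ.* ℤ.+ 1 ℤ.+ ℤ.+ b ℤ.* ℤ.+ 1
      core = sym (cong₂ ℤ._+_ (ℤₚ.*-identityʳ (ℤ.+ a)) (ℤₚ.*-identityʳ (ℤ.+ b)))

    ι-* : ∀ a b → ι (a * b) ≡ ι a ℚ.* ι b
    ι-* a b = ℚₚ.toℚᵘ-injective (ℚᵘₚ.≃-trans (ι-toℚᵘ (a * b)) (ℚᵘₚ.≃-trans (ℚᵘ.*≡* (cong (ℤ._* ℤ.+ 1) (ℤₚ.pos-* a b)))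
      (ℚᵘₚ.≃-sym (ℚᵘₚ.≃-trans (ℚₚ.toℚᵘ-homo-* (ι a) (ι b)) (ℚᵘₚ.*-cong (ι-toℚᵘ a) (ι-toℚᵘ b))))))

    ι-mono : ∀ {a b} → a ≤ b → ι a ℚ.≤ ι b
    ι-mono {a} {b} a≤b = ℚₚ.toℚᵘ-cancel-≤ (ℚᵘₚ.≤-respˡ-≃ (ℚᵘₚ.≃-sym (ι-toℚᵘ a)) (ℚᵘₚ.≤-respʳ-≃ (ℚᵘₚ.≃-sym (ι-toℚᵘ b))
      (ℚᵘ.*≤* (ℤₚ.*-monoʳ-≤-nonNeg (ℤ.+ 1) (ℤ.+≤+ a≤b)))))

    ι-def : ∀ m → ι m ≡ ℤ.+ m ℚ./ 1
    ι-def m = refl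

  ι-0-* : ∀ x → ι 0 ℚ.* x ≡ 0ℚ
  ι-0-* x = trans (cong (ℚ._* x) (ι-def 0)) (ℚₚ.*-zeroˡ x)

  ι-1-* : ∀ x → ι 1 ℚ.* x ≡ x
  ι-1-* x = trans (cong (ℚ._* x) (ι-def 1)) (ℚₚ.*-identityˡ x)

  0≤ι : ∀ m → 0ℚ ℚ.≤ ι m
  0≤ι m = subst (ℚ._≤ ι m) (ι-def 0) (ι-mono {0} {m} z≤n)

  ι-*-monoʳ : ∀ m {x y} → x ℚ.≤ y → ι m ℚ.* x ℚ.≤ ι m ℚ.* y
  ι-*-monoʳ m = ℚₚ.*-monoˡ-≤-nonNeg (ι m) {{ℚ.nonNegative (0≤ι m)}}

  ι-*-monoˡ : ∀ {a b x} → 0ℚ ℚ.≤ x → a ≤ b → ι a ℚ.* x ℚ.≤ ι b ℚ.* x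
  ι-*-monoˡ {x = x} 0≤x a≤b = ℚₚ.*-monoʳ-≤-nonNeg x {{ℚ.nonNegative 0≤x}} (ι-mono a≤b)

  ι-*-nonNeg : ∀ m {x} → 0ℚ ℚ.≤ x → 0ℚ ℚ.≤ ι m ℚ.* x
  ι-*-nonNeg m {x} 0≤x = subst (ℚ._≤ ι m ℚ.* x) (ι-0-* x) (ι-*-monoˡ {0} {m} 0≤x z≤n)

  𝟙-*-mono : ∀ {P : Set} (p : Dec P) {x y} → (P → x ℚ.≤ y) → ι (𝟙 p) ℚ.* x ℚ.≤ ι (𝟙 p) ℚ.* y
  𝟙-*-mono (yes p) f = ι-*-monoʳ 1 (f p)
  𝟙-*-mono (no _) {x} {y} f = ℚₚ.≤-reflexive (trans (ι-0-* x) (sym (ι-0-* y)))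

  ι-assoc : ∀ a b x → ι a ℚ.* (ι b ℚ.* x) ≡ ι (a * b) ℚ.* x
  ι-assoc a b x = trans (sym (ℚₚ.*-assoc (ι a) (ι b) x)) (cong (ℚ._* x) (sym (ι-* a b)))

  ∑ℚ : List A → (A → ℚ) → ℚ
  ∑ℚ xs f = sumℚ (map f xs)

  ∑ℚ-mono : ∀ (xs : List A) {f g : A → ℚ} → (∀ x → x ∈ xs → f x ℚ.≤ g x) → ∑ℚ xs f ℚ.≤ ∑ℚ xs g
  ∑ℚ-mono []       h = ℚₚ.≤-refl
  ∑ℚ-mono (x ∷ xs) h = ℚₚ.+-mono-≤ (h x (here refl)) (∑ℚ-mono xs (λ y y∈ → h y (there y∈)))

  ∑ℚ-cong : ∀ (xs : List A) {f g : A → ℚ} → (∀ x → f x ≡ g x) → ∑ℚ xs f ≡ ∑ℚ xs g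
  ∑ℚ-cong xs h = cong sumℚ (Lₚ.map-cong h xs)

  ∑ℚ-+ : ∀ (xs : List A) (f g : A → ℚ) → ∑ℚ xs (λ x → f x ℚ.+ g x) ≡ ∑ℚ xs f ℚ.+ ∑ℚ xs g
  ∑ℚ-+ []       f g = refl
  ∑ℚ-+ (x ∷ xs) f g = trans (cong ((f x ℚ.+ g x) ℚ.+_) (∑ℚ-+ xs f g)) (interchange (f x) (g x) (∑ℚ xs f) (∑ℚ xs g))
    where
    interchange : ∀ a b c d → (a ℚ.+ b) ℚ.+ (c ℚ.+ d) ≡ (a ℚ.+ c) ℚ.+ (b ℚ.+ d)
    interchange = solve 4 (λ a b c d → (a :+ b) :+ (c :+ d) := (a :+ c) :+ (b :+ d)) refl
      where open ℚ-Solver.+-*-Solver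

  ∑ℚ-*ˡ : ∀ (xs : List A) k (f : A → ℚ) → ∑ℚ xs (λ x → k ℚ.* f x) ≡ k ℚ.* ∑ℚ xs f
  ∑ℚ-*ˡ []       k f = sym (ℚₚ.*-zeroʳ k)
  ∑ℚ-*ˡ (x ∷ xs) k f = trans (cong (k ℚ.* f x ℚ.+_) (∑ℚ-*ˡ xs k f)) (sym (ℚₚ.*-distribˡ-+ k (f x) _))

  ∑ℚ-ι* : ∀ (xs : List A) (f : A → ℕ) v → ∑ℚ xs (λ x → ι (f x) ℚ.* v) ≡ ι (∑ xs f) ℚ.* v
  ∑ℚ-ι* []       f v = sym (ι-0-* v)
  ∑ℚ-ι* (x ∷ xs) f v = trans (cong (ι (f x) ℚ.* v ℚ.+_) (∑ℚ-ι* xs f v))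
    (trans (sym (ℚₚ.*-distribʳ-+ v (ι (f x)) (ι (∑ xs f)))) (cong (ℚ._* v) (sym (ι-+ (f x) (∑ xs f)))))

  ∑ℚ-zero : ∀ (xs : List A) → ∑ℚ xs (λ _ → 0ℚ) ≡ 0ℚ
  ∑ℚ-zero []       = refl
  ∑ℚ-zero (x ∷ xs) = trans (ℚₚ.+-identityˡ _) (∑ℚ-zero xs)

  ∑ℚ-weighted-swap : ∀ (xs : List A) (ys : List B) (c : A → B → ℕ) (w : B → ℚ) →
    ∑ℚ xs (λ x → ∑ℚ ys (λ y → ι (c x y) ℚ.* w y)) ≡ ∑ℚ ys (λ y → ι (∑ xs (λ x → c x y)) ℚ.* w y)
  ∑ℚ-weighted-swap []       ys c w = sym (trans (∑ℚ-cong ys (λ y → ι-0-* (w y))) (∑ℚ-zero ys))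
  ∑ℚ-weighted-swap (x ∷ xs) ys c w = trans (cong (∑ℚ ys (λ y → ι (c x y) ℚ.* w y) ℚ.+_) (∑ℚ-weighted-swap xs ys c w))
    (trans (sym (∑ℚ-+ ys _ _)) (∑ℚ-cong ys (λ y →
      trans (sym (ℚₚ.*-distribʳ-+ (w y) (ι (c x y)) _)) (cong (ℚ._* w y) (sym (ι-+ (c x y) _))))))

  sumℚ-filter : ∀ {P : A → Set} (P? : ∀ x → Dec (P x)) (w : A → ℚ) xs →
                sumℚ (map w (filter P? xs)) ≡ ∑ℚ xs (λ x → ι (𝟙 (P? x)) ℚ.* w x)
  sumℚ-filter P? w []       = refl
  sumℚ-filter P? w (x ∷ xs) with P? x
  ... | yes _ = cong₂ ℚ._+_ (sym (ι-1-* (w x))) (sumℚ-filter P? w xs)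
  ... | no _  = trans (sumℚ-filter P? w xs) (sym (trans (cong (ℚ._+ ∑ℚ xs (λ x → ι (𝟙 (P? x)) ℚ.* w x)) (ι-0-* (w x))) (ℚₚ.+-identityˡ _)))

  -- The greedy run and a lower bound for its value

  module _ (M : Matroid n) (w : Fin n → ℚ) (π : Vec (Fin n) n) where

    accepts : Fin n → Subset n → Bool
    accepts e S = ⌊ n / 2 ≤? toℕ e ⌋ ∧ beats (threshold w (n / 2) (rk M / 4) π) (w (lookup π e)) ∧ Matroid.indep M (⁅ e ⁆ ∪ S)

    greedy : List (Fin n) → Subset n → ℚ → ℚ
    greedy []       S acc = acc
    greedy (e ∷ es) S acc = if accepts e S then greedy es (⁅ e ⁆ ∪ S) (acc ℚ.+ w (lookup π e)) else greedy es S acc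

    greedy-unique : (g : List (Fin n) → Subset n → ℚ → ℚ) → (∀ S acc → g [] S acc ≡ acc) →
      (∀ e es S acc → g (e ∷ es) S acc ≡ (if accepts e S then g es (⁅ e ⁆ ∪ S) (acc ℚ.+ w (lookup π e)) else g es S acc)) →
      ∀ es S acc → g es S acc ≡ greedy es S acc
    greedy-unique g p q []       S acc = p S acc
    greedy-unique g p q (e ∷ es) S acc with accepts e S | q e es S acc
    ... | true  | eq = trans eq (greedy-unique g p q es _ _)
    ... | false | eq = trans eq (greedy-unique g p q es _ _)

  -- The local loop of `thresholdGreedy` is reached as in `optCutoff≡argmax`: with variables for its
  -- arguments, unification finds it as the `g` of `greedy-unique`.
  thresholdGreedy≡greedy : ∀ (M : Matroid n) w π → thresholdGreedy M w π ≡ greedy M w π (allFin n) ⊥ 0ℚ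
  thresholdGreedy≡greedy {n} M w π with greedy-unique M w π _ (λ _ _ → refl) (λ _ _ _ _ → refl) | allFin n | ⊥ {n} | 0ℚ
  ... | loop≡ | es | S | acc = loop≡ es S acc

  ∑-perm-≤ : ∀ (π : Vec (Fin n) n) → Inj π → (f : Fin n → ℕ) → ∑ (allFin n) (f ∘ lookup π) ≤ ∑ (allFin n) f
  ∑-perm-≤ {n} π inj f = begin
    ∑ (allFin n) (f ∘ lookup π) ≤⟨ ∑-mono (allFin n) (λ a _ → term a) ⟩
    ∑ (allFin n) (λ a → ∑ (allFin n) (λ i → 𝟙 (lookup π a ≟ i) * f i)) ≡⟨ ∑-swap (allFin n) (allFin n) _ ⟩
    ∑ (allFin n) (λ i → ∑ (allFin n) (λ a → 𝟙 (lookup π a ≟ i) * f i))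
      ≡⟨ ∑-cong (allFin n) (λ i → trans (∑-*ʳ (allFin n) (f i) _) (trans (cong (_* f i) (∑-preimage π inj i)) (ℕₚ.*-identityˡ (f i)))) ⟩
    ∑ (allFin n) f ∎
    where
    open ℕₚ.≤-Reasoning
    term : ∀ a → f (lookup π a) ≤ ∑ (allFin n) (λ i → 𝟙 (lookup π a ≟ i) * f i)
    term a = ℕₚ.≤-trans (ℕₚ.≤-reflexive (trans (sym (ℕₚ.*-identityˡ _)) (cong (_* f (lookup π a)) (sym (𝟙-true (lookup π a ≟ lookup π a) refl)))))
      (∈⇒≤∑ (λ i → 𝟙 (lookup π a ≟ i) * f i) (∈-allFin (lookup π a)))

  -- The sampled weights that reach the weight of a late `e` have distinct indices strictly below
  -- its own. So a late element carrying one of the q + 1 largest weights always passes the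
  -- threshold.
  atLeast≤ : ∀ {h} (π : Vec (Fin n) n) → Inj π → ∀ e → h ≤ toℕ e → atLeast h π (lookup π e) ≤ toℕ (lookup π e)
  atLeast≤ {n} {h} π inj e h≤e = begin
    atLeast h π v ≤⟨ ∑-mono (allFin n) (λ a _ → 𝟙-mono ((toℕ a <? h) ×-dec (toℕ (lookup π a) ≤? toℕ v)) (toℕ (lookup π a) <? toℕ v) (smaller a)) ⟩
    ∑ (allFin n) (λ a → 𝟙 (toℕ (lookup π a) <? toℕ v)) ≤⟨ ∑-perm-≤ π inj (λ i → 𝟙 (toℕ i <? toℕ v)) ⟩
    ∑ (allFin n) (λ i → 𝟙 (toℕ i <? toℕ v)) ≡⟨ count-< n (toℕ v) (ℕₚ.<⇒≤ (Finₚ.toℕ<n v)) ⟩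
    toℕ v ∎
    where
    open ℕₚ.≤-Reasoning
    v = lookup π e
    smaller : ∀ a → toℕ a < h × toℕ (lookup π a) ≤ toℕ v → toℕ (lookup π a) < toℕ v
    smaller a (a<h , le) = ℕₚ.≤∧≢⇒< le (λ eq → ℕₚ.<⇒≱ a<h (subst (λ x → h ≤ toℕ x) (sym (inj (Finₚ.toℕ-injective eq))) h≤e))

  module _ (M : Matroid n) (w : Fin n → ℚ) (0≤w : ∀ i → 0ℚ ℚ.≤ w i) (dec : StrictlyDecreasing w) where
    open Matroid M

    private
      h = n / 2
      q = rk M / 4

    -- A sufficient condition for selection that refers to the bijection only and not to the greedy
    -- run.
    Good : Vec (Fin n) n → Fin n → Set
    Good π e = toℕ (lookup π e) < suc q × Free M h q π (lookup π e) e

    good? : ∀ π e → Dec (Good π e)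
    good? π e = (toℕ (lookup π e) <? suc q) ×-dec free? M h q π (lookup π e) e

    gain : Vec (Fin n) n → Fin n → ℚ
    gain π e = ι (𝟙 (good? π e)) ℚ.* w (lookup π e)

    0≤gain : ∀ π e → 0ℚ ℚ.≤ gain π e
    0≤gain π e = ι-*-nonNeg (𝟙 (good? π e)) (0≤w _)

    true-∧ : ∀ {a b c} → a ≡ true → b ≡ true → c ≡ true → (a ∧ b ∧ c) ≡ true
    true-∧ refl refl refl = refl

    ∧-true : ∀ {a b c} → (a ∧ b ∧ c) ≡ true → a ≡ true × b ≡ true × c ≡ true
    ∧-true {true} {true} {true} _ = refl , refl , refl

    -- Invariant: whatever is held is late, passes the threshold and does not arrive again. Hence
    -- `S` lies inside the rivals of the weight at the next `e`, and `indep-insert` shows that a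
    -- good `e` is accepted; a rejected `e` is not good and gains nothing.
    greedy-gains : ∀ π → Inj π → ∀ es S acc → Unique es → indep S ≡ true →
      (∀ {x} → x ∈ₛ S → h ≤ toℕ x × atLeast h π (lookup π x) ≤ q × ¬ (x ∈ es)) →
      acc ℚ.+ ∑ℚ es (gain π) ℚ.≤ greedy M w π es S acc
    greedy-gains π inj []       S acc u iS inv = ℚₚ.≤-reflexive (ℚₚ.+-identityʳ acc)
    greedy-gains π inj (e ∷ es) S acc (e∉es ∷ u) iS inv = step (accepts M w π e S) refl
      where
      open ℚₚ.≤-Reasoning
      gain≤ : gain π e ℚ.≤ w (lookup π e)
      gain≤ = ℚₚ.≤-trans (ι-*-monoˡ (0≤w _) (𝟙≤1 (good? π e))) (ℚₚ.≤-reflexive (ι-1-* _))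
      accepted : Good π e → accepts M w π e S ≡ true
      accepted (top , h≤e , e∉) = true-∧ (⌊⌋-true (h ≤? toℕ e) h≤e)
        (atLeast⇒beats w dec h q π (lookup π e) (ℕₚ.≤-trans (atLeast≤ π inj e h≤e) (ℕ.s≤s⁻¹ top)))
        (indep-insert M e∉ S⊆rivals iS)
        where
        S⊆rivals : S ⊆ rivals M h q π (lookup π e)
        S⊆rivals {x} x∈ = let (a , b , c) = inv x∈ in
          ∈-⟦⟧⁺ (rival? M h q π (lookup π e)) (a , (λ πx≡πe → c (here (inj πx≡πe))) , b)
      step : ∀ c → accepts M w π e S ≡ c → acc ℚ.+ (gain π e ℚ.+ ∑ℚ es (gain π)) ℚ.≤
             (if c then greedy M w π es (⁅ e ⁆ ∪ S) (acc ℚ.+ w (lookup π e)) else greedy M w π es S acc)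
      step true eq = begin
        acc ℚ.+ (gain π e ℚ.+ ∑ℚ es (gain π))               ≡⟨ ℚₚ.+-assoc acc (gain π e) _ ⟨
        (acc ℚ.+ gain π e) ℚ.+ ∑ℚ es (gain π)               ≤⟨ ℚₚ.+-monoˡ-≤ (∑ℚ es (gain π)) (ℚₚ.+-monoʳ-≤ acc gain≤) ⟩
        (acc ℚ.+ w (lookup π e)) ℚ.+ ∑ℚ es (gain π)         ≤⟨ greedy-gains π inj es (⁅ e ⁆ ∪ S) (acc ℚ.+ w (lookup π e)) u (proj₂ (proj₂ cond)) inv′ ⟩
        greedy M w π es (⁅ e ⁆ ∪ S) (acc ℚ.+ w (lookup π e)) ∎
        where
        cond = ∧-true {⌊ h ≤? toℕ e ⌋} {beats (threshold w h q π) (w (lookup π e))} eq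
        inv′ : ∀ {x} → x ∈ₛ ⁅ e ⁆ ∪ S → h ≤ toℕ x × atLeast h π (lookup π x) ≤ q × ¬ (x ∈ es)
        inv′ {x} x∈ with x ≟ e
        ... | yes refl = ⌊⌋-sound (h ≤? toℕ e) (proj₁ cond) , beats⇒atLeast w dec h q π (lookup π e) (proj₁ (proj₂ cond)) ,
                         λ x∈es → All.lookup e∉es x∈es refl
        ... | no x≢e   = let (a , b , c) = inv (∈-insert⁻ x∈ x≢e) in a , b , c ∘ there
      step false eq = begin
        acc ℚ.+ (gain π e ℚ.+ ∑ℚ es (gain π)) ≡⟨ cong (λ g → acc ℚ.+ (g ℚ.+ ∑ℚ es (gain π))) gain≡0 ⟩
        acc ℚ.+ (0ℚ ℚ.+ ∑ℚ es (gain π))       ≡⟨ cong (acc ℚ.+_) (ℚₚ.+-identityˡ _) ⟩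
        acc ℚ.+ ∑ℚ es (gain π)                ≤⟨ greedy-gains π inj es S acc u iS (λ x∈ → let (a , b , c) = inv x∈ in a , b , c ∘ there) ⟩
        greedy M w π es S acc                 ∎
        where
        gain≡0 : gain π e ≡ 0ℚ
        gain≡0 = trans (cong (λ k → ι k ℚ.* w (lookup π e))
          (𝟙-false (good? π e) (λ g → contradiction (trans (sym (accepted g)) eq) (λ ())))) (ι-0-* _)

    thresholdGreedy-gains : ∀ π → Inj π → ∑ℚ (allFin n) (gain π) ℚ.≤ thresholdGreedy M w π
    thresholdGreedy-gains π inj = begin
      ∑ℚ (allFin n) (gain π)            ≡⟨ ℚₚ.+-identityˡ _ ⟨
      0ℚ ℚ.+ ∑ℚ (allFin n) (gain π)     ≤⟨ greedy-gains π inj (allFin n) ⊥ 0ℚ (Uₚ.allFin⁺ n) indep-∅ (λ x∈ → contradiction x∈ Sₚ.∉⊥) ⟩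
      greedy M w π (allFin n) ⊥ 0ℚ      ≡⟨ thresholdGreedy≡greedy M w π ⟨
      thresholdGreedy M w π             ∎
      where open ℚₚ.≤-Reasoning

    -- The coefficient of `w i` in the gain at `e`. Indexing by the weight instead of reading it off
    -- `π` allows the sums over bijections and over weights to be exchanged.
    share : Vec (Fin n) n → Fin n → Fin n → ℕ
    share π e i = 𝟙 (toℕ i <? suc q) * 𝟙 ((lookup π e ≟ i) ×-dec free? M h q π i e)

    shares≤gain : ∀ π e → ∑ℚ (allFin n) (λ i → ι (share π e i) ℚ.* w i) ℚ.≤ gain π e
    shares≤gain π e = begin
      ∑ℚ (allFin n) (λ i → ι (share π e i) ℚ.* w i) ≤⟨ ∑ℚ-mono (allFin n) (λ i _ → term i (lookup π e ≟ i)) ⟩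
      ∑ℚ (allFin n) (λ i → ι (𝟙 (lookup π e ≟ i)) ℚ.* gain π e) ≡⟨ ∑ℚ-ι* (allFin n) (λ i → 𝟙 (lookup π e ≟ i)) (gain π e) ⟩
      ι (∑ (allFin n) (λ i → 𝟙 (lookup π e ≟ i))) ℚ.* gain π e
        ≤⟨ ι-*-monoˡ (0≤gain π e) (∑-𝟙≤1 (λ i → lookup π e ≟ i) (Uₚ.allFin⁺ n) (λ x y p r → trans (sym p) r)) ⟩
      ι 1 ℚ.* gain π e ≡⟨ ι-1-* _ ⟩
      gain π e ∎
      where
      open ℚₚ.≤-Reasoning
      term : ∀ i (d : Dec (lookup π e ≡ i)) → ι (share π e i) ℚ.* w i ℚ.≤ ι (𝟙 d) ℚ.* gain π e
      term i (yes refl) = ℚₚ.≤-trans (ι-*-monoˡ (0≤w _) (ℕₚ.≤-trans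
          (ℕₚ.≤-reflexive (sym (𝟙-× (toℕ i <? suc q) ((lookup π e ≟ i) ×-dec free? M h q π i e))))
          (𝟙-mono ((toℕ i <? suc q) ×-dec ((lookup π e ≟ i) ×-dec free? M h q π i e)) (good? π e) (λ (a , _ , c) → a , c))))
        (ℚₚ.≤-reflexive (sym (ι-1-* _)))
      term i (no ≢i) = ℚₚ.≤-trans (ℚₚ.≤-reflexive (trans (cong (λ k → ι k ℚ.* w i)
          (trans (cong (𝟙 (toℕ i <? suc q) *_) (𝟙-false ((lookup π e ≟ i) ×-dec free? M h q π i e) (≢i ∘ proj₁))) (ℕₚ.*-zeroʳ (𝟙 (toℕ i <? suc q)))))
          (ι-0-* (w i))))
        (ι-*-nonNeg 0 (0≤gain π e))

    -- Linearity of expectation: after the exchange each of the q + 1 largest weights is multiplied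
    -- by the number of bijections in which its carrier is free.
    expected-gain : ∑ℚ (allFin n) (λ i → ι (𝟙 (toℕ i <? suc q) * goodCount M h q i) ℚ.* w i) ℚ.≤
                    ∑ℚ (allPerms n) (thresholdGreedy M w)
    expected-gain = begin
      ∑ℚ (allFin n) (λ i → ι (𝟙 (toℕ i <? suc q) * goodCount M h q i) ℚ.* w i)
        ≡⟨ ∑ℚ-cong (allFin n) (λ i → cong (λ k → ι k ℚ.* w i) (sym (trans (∑-cong (allPerms n) (λ π → ∑-*ˡ (allFin n) (𝟙 (toℕ i <? suc q)) _)) (∑-*ˡ (allPerms n) (𝟙 (toℕ i <? suc q)) _)))) ⟩
      ∑ℚ (allFin n) (λ i → ι (∑ (allPerms n) (λ π → ∑ (allFin n) (λ e → share π e i))) ℚ.* w i)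
        ≡⟨ ∑ℚ-weighted-swap (allPerms n) (allFin n) (λ π i → ∑ (allFin n) (λ e → share π e i)) w ⟨
      ∑ℚ (allPerms n) (λ π → ∑ℚ (allFin n) (λ i → ι (∑ (allFin n) (λ e → share π e i)) ℚ.* w i))
        ≡⟨ ∑ℚ-cong (allPerms n) (λ π → ∑ℚ-weighted-swap (allFin n) (allFin n) (share π) w) ⟨
      ∑ℚ (allPerms n) (λ π → ∑ℚ (allFin n) (λ e → ∑ℚ (allFin n) (λ i → ι (share π e i) ℚ.* w i)))
        ≤⟨ ∑ℚ-mono (allPerms n) (λ π π∈ → ℚₚ.≤-trans (∑ℚ-mono (allFin n) (λ e _ → shares≤gain π e)) (thresholdGreedy-gains π (allPerms-injective π∈))) ⟩
      ∑ℚ (allPerms n) (thresholdGreedy M w) ∎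
      where open ℚₚ.≤-Reasoning

  -- The two regimes of the rank

  half-cases : ∀ n → n ≡ n / 2 + n / 2 ⊎ n ≡ suc (n / 2 + n / 2)
  half-cases n = cases (n % 2) (m%n<n n 2) (m≡m%n+[m/n]*n n 2)
    where
    double : n / 2 * 2 ≡ n / 2 + n / 2
    double = trans (ℕₚ.*-comm (n / 2) 2) (cong (n / 2 +_) (ℕₚ.+-identityʳ _))
    cases : ∀ s → s < 2 → n ≡ s + n / 2 * 2 → n ≡ n / 2 + n / 2 ⊎ n ≡ suc (n / 2 + n / 2)
    cases 0 _ eq = inj₁ (trans eq double)
    cases 1 _ eq = inj₂ (trans eq (cong suc double))
    cases (suc (suc _)) (s≤s (s≤s ())) _

  -- With r = s + 4(3 + p) and s < 4 the difference of the two sides is a polynomial with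
  -- nonnegative coefficients, apart from -s², which 56 s absorbs. At r = 12 the claim reads 144 ≤
  -- 160; at r = 9 it would read 81 ≤ 60.
  ratio-bound : ∀ r → 12 ≤ r → r * r ≤ 20 * suc (r / 4) * (r ∸ 2 * (2 + r / 4))
  ratio-bound r 12≤r = bound (r / 4) (r % 4) (m/n-lower) (m%n<n r 4) (m≡m%n+[m/n]*n r 4)
    where
    open ℕₚ.≤-Reasoning
    m/n-lower : 3 ≤ r / 4
    m/n-lower = /-monoˡ-≤ 4 12≤r
    expand : ∀ p s → (s + (3 + p) * 4) * (s + (3 + p) * 4) + (16 + 104 * p + 24 * (p * p) + 12 * (p * s)) + 56 * s ≡
                     20 * suc (3 + p) * (2 + 2 * p + s) + s * s
    expand = solve-∀
    split : ∀ p s → s + (3 + p) * 4 ≡ 2 * (2 + (3 + p)) + (2 + 2 * p + s)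
    split = solve-∀
    bound : ∀ q s → 3 ≤ q → s < 4 → r ≡ s + q * 4 → r * r ≤ 20 * suc q * (r ∸ 2 * (2 + q))
    bound q s 3≤q s<4 eq with ℕₚ.m≤n⇒∃[o]m+o≡n 3≤q
    ... | p , refl = subst (λ r → r * r ≤ 20 * suc (3 + p) * (r ∸ 2 * (2 + (3 + p)))) (sym eq)
      (subst (λ d → R * R ≤ 20 * suc (3 + p) * d) (sym (trans (cong (_∸ 2 * (2 + (3 + p))) (split p s)) (ℕₚ.m+n∸m≡n (2 * (2 + (3 + p))) _)))
        (ℕₚ.m+n≤o⇒m≤o (R * R) (ℕₚ.+-cancelʳ-≤ (56 * s) _ _ (begin
          R * R + (16 + 104 * p + 24 * (p * p) + 12 * (p * s)) + 56 * s ≡⟨ expand p s ⟩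
          20 * suc (3 + p) * (2 + 2 * p + s) + s * s ≤⟨ ℕₚ.+-monoʳ-≤ (20 * suc (3 + p) * (2 + 2 * p + s)) (ℕₚ.*-monoˡ-≤ s (ℕₚ.≤-trans (ℕₚ.<⇒≤ s<4) (ℕₚ.m≤m+n 4 52))) ⟩
          20 * suc (3 + p) * (2 + 2 * p + s) + 56 * s ∎))))
      where R = s + (3 + p) * 4

  topSum : (Fin n → ℚ) → ℕ → ℚ
  topSum {n} w k = ∑ℚ (allFin n) (λ i → ι (𝟙 (toℕ i <? k)) ℚ.* w i)

  module _ (w : Fin n → ℚ) (dec : StrictlyDecreasing w) where

    private
      top = topSum w

    -- The weights of index above k are at most v = w k, the others are at least v.
    top-ratio : ∀ k r → k < r → r ≤ n → ι (suc k) ℚ.* top r ℚ.≤ ι r ℚ.* top (suc k)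
    top-ratio k r k<r r≤n = begin
      ι (suc k) ℚ.* top r                                              ≤⟨ ι-*-monoʳ (suc k) upper ⟩
      ι (suc k) ℚ.* (top (suc k) ℚ.+ ι s ℚ.* v)                         ≡⟨ rearrange (ι (suc k)) (top (suc k)) (ι s) v ⟩
      ι (suc k) ℚ.* top (suc k) ℚ.+ ι s ℚ.* (ι (suc k) ℚ.* v)           ≤⟨ ℚₚ.+-monoʳ-≤ (ι (suc k) ℚ.* top (suc k)) (ι-*-monoʳ s lower) ⟩
      ι (suc k) ℚ.* top (suc k) ℚ.+ ι s ℚ.* top (suc k)                 ≡⟨ ℚₚ.*-distribʳ-+ (top (suc k)) (ι (suc k)) (ι s) ⟨
      (ι (suc k) ℚ.+ ι s) ℚ.* top (suc k)                               ≡⟨ cong (ℚ._* top (suc k)) (trans (sym (ι-+ (suc k) s)) (cong ι k+s≡r)) ⟩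
      ι r ℚ.* top (suc k)                                              ∎
      where
      open ℚₚ.≤-Reasoning
      rearrange : ∀ a x s v → a ℚ.* (x ℚ.+ s ℚ.* v) ≡ a ℚ.* x ℚ.+ s ℚ.* (a ℚ.* v)
      rearrange = solve 4 (λ a x s v → a :* (x :+ s :* v) := a :* x :+ s :* (a :* v)) refl
        where open ℚ-Solver.+-*-Solver
      k<n : k < n
      k<n = ℕₚ.<-≤-trans k<r r≤n
      v = w (fromℕ< k<n)
      mid? : ∀ i → Dec (k < toℕ i × toℕ i < r)
      mid? i = (k <? toℕ i) ×-dec (toℕ i <? r)
      s = ∑ (allFin n) (λ i → 𝟙 (mid? i))
      split : ∀ i → 𝟙 (toℕ i <? suc k) + 𝟙 (mid? i) ≡ 𝟙 (toℕ i <? r)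
      split i = ℕₚ.≤-antisym
        (𝟙-⊎ (toℕ i <? suc k) (mid? i) (toℕ i <? r) (λ lt → ℕₚ.≤-<-trans (ℕ.s≤s⁻¹ lt) k<r) proj₂ (λ lt (gt , _) → ℕₚ.<⇒≱ gt (ℕ.s≤s⁻¹ lt)))
        (𝟙≤ (toℕ i <? r) (λ i<r → cover (toℕ i <? suc k) (λ ≮ → ℕₚ.≮⇒≥ ≮ , i<r)))
        where
        cover : (d : Dec (toℕ i < suc k)) → (¬ toℕ i < suc k → k < toℕ i × toℕ i < r) → 1 ≤ 𝟙 d + 𝟙 (mid? i)
        cover (yes _) _ = s≤s z≤n
        cover (no ≮)  f = ℕₚ.≤-reflexive (sym (𝟙-true (mid? i) (f ≮)))
      k+s≡r : suc k + s ≡ r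
      k+s≡r = trans (cong (_+ s) (sym (count-< n (suc k) k<n)))
        (trans (sym (∑-+ (allFin n) _ _)) (trans (∑-cong (allFin n) split) (count-< n r r≤n)))
      upper : top r ℚ.≤ top (suc k) ℚ.+ ι s ℚ.* v
      upper = begin
        top r ≡⟨ ∑ℚ-cong (allFin n) (λ i → trans (cong (λ x → ι x ℚ.* w i) (sym (split i))) (trans (cong (ℚ._* w i) (ι-+ (𝟙 (toℕ i <? suc k)) (𝟙 (mid? i)))) (ℚₚ.*-distribʳ-+ (w i) (ι (𝟙 (toℕ i <? suc k))) (ι (𝟙 (mid? i)))))) ⟩
        ∑ℚ (allFin n) (λ i → ι (𝟙 (toℕ i <? suc k)) ℚ.* w i ℚ.+ ι (𝟙 (mid? i)) ℚ.* w i) ≡⟨ ∑ℚ-+ (allFin n) _ _ ⟩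
        top (suc k) ℚ.+ ∑ℚ (allFin n) (λ i → ι (𝟙 (mid? i)) ℚ.* w i) ≤⟨ ℚₚ.+-monoʳ-≤ (top (suc k)) (∑ℚ-mono (allFin n) (λ i _ → 𝟙-*-mono (mid? i) (λ (gt , _) → decreasing dec (subst (_≤ toℕ i) (sym (Finₚ.toℕ-fromℕ< k<n)) (ℕₚ.<⇒≤ gt))))) ⟩
        top (suc k) ℚ.+ ∑ℚ (allFin n) (λ i → ι (𝟙 (mid? i)) ℚ.* v) ≡⟨ cong (top (suc k) ℚ.+_) (∑ℚ-ι* (allFin n) _ v) ⟩
        top (suc k) ℚ.+ ι s ℚ.* v ∎
      lower : ι (suc k) ℚ.* v ℚ.≤ top (suc k)
      lower = begin
        ι (suc k) ℚ.* v ≡⟨ cong (λ m → ι m ℚ.* v) (count-< n (suc k) k<n) ⟨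
        ι (∑ (allFin n) (λ i → 𝟙 (toℕ i <? suc k))) ℚ.* v ≡⟨ ∑ℚ-ι* (allFin n) _ v ⟨
        ∑ℚ (allFin n) (λ i → ι (𝟙 (toℕ i <? suc k)) ℚ.* v) ≤⟨ ∑ℚ-mono (allFin n) (λ i _ → 𝟙-*-mono (toℕ i <? suc k) (λ lt → decreasing dec (subst (toℕ i ≤_) (sym (Finₚ.toℕ-fromℕ< k<n)) (ℕ.s≤s⁻¹ lt)))) ⟩
        top (suc k) ∎

    top-max : ∀ r → r ≤ n → (z : Fin n) → toℕ z ≡ 0 → top r ℚ.≤ ι r ℚ.* w z
    top-max r r≤n z z≡0 = begin
      top r ≤⟨ ∑ℚ-mono (allFin n) (λ i _ → ι-*-monoʳ (𝟙 (toℕ i <? r)) (decreasing dec (subst (_≤ toℕ i) (sym z≡0) z≤n))) ⟩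
      ∑ℚ (allFin n) (λ i → ι (𝟙 (toℕ i <? r)) ℚ.* w z) ≡⟨ ∑ℚ-ι* (allFin n) _ (w z) ⟩
      ι (∑ (allFin n) (λ i → 𝟙 (toℕ i <? r))) ℚ.* w z ≡⟨ cong (λ m → ι m ℚ.* w z) (count-< n r r≤n) ⟩
      ι r ℚ.* w z ∎
      where open ℚₚ.≤-Reasoning

  firstBeating-nonNeg : ∀ t xs → (∀ {x} → x ∈ xs → 0ℚ ℚ.≤ x) → 0ℚ ℚ.≤ firstBeating t xs
  firstBeating-nonNeg t []       h = ℚₚ.≤-refl
  firstBeating-nonNeg t (x ∷ xs) h with beats t x
  ... | true  = h (here refl)
  ... | false = firstBeating-nonNeg t xs (h ∘ there)

  drop-⊆ : ∀ {A : Set} k (xs : List A) {x} → x ∈ drop k xs → x ∈ xs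
  drop-⊆ zero    xs       x∈ = x∈
  drop-⊆ (suc k) (y ∷ xs) x∈ = there (drop-⊆ k xs x∈)

  -- A single element is treated apart: half of 1 is 0, which leaves no sample for `halfway-wins`,
  -- but cutoff 0 then always succeeds.
  best-successCount : ∀ {m} (w : Fin (suc m) → ℚ) → StrictlyDecreasing w →
                      11 * length (allPerms (suc m)) ≤ 40 * successCount w fzero (optCutoff w fzero)
  best-successCount {zero} w dec = begin
    11 * N                                                ≤⟨ ℕₚ.*-monoˡ-≤ N (ℕₚ.m≤m+n 11 29) ⟩
    40 * N                                                ≤⟨ ℕₚ.*-monoʳ-≤ 40 always ⟩
    40 * successCount w fzero 0                           ≤⟨ ℕₚ.*-monoʳ-≤ 40 (optCutoff-max w fzero 0 z≤n) ⟩
    40 * successCount w fzero (optCutoff w fzero)         ∎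
    where
    open ℕₚ.≤-Reasoning
    N = length (allPerms 1)
    always : N ≤ successCount w fzero 0
    always = begin
      N ≡⟨ ∑-one (allPerms 1) ⟨
      ∑ (allPerms 1) (λ _ → 1) ≤⟨ ∑-mono (allPerms 1) (λ π _ → ℕₚ.≤-reflexive (sym (𝟙-true (secretaryCutoff 0 (weightsInOrder w π) ℚ.≟ w fzero) (cong w (only (lookup π fzero)))))) ⟩
      ∑ (allPerms 1) (λ π → 𝟙 (secretaryCutoff 0 (weightsInOrder w π) ℚ.≟ w fzero)) ≡⟨ length-filter (λ π → secretaryCutoff 0 (weightsInOrder w π) ℚ.≟ w fzero) (allPerms 1) ⟨
      successCount w fzero 0 ∎
      where
      only : (x : Fin 1) → x ≡ fzero
      only fzero = refl
  best-successCount {suc m} w dec = begin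
    11 * length (allPerms n′)                              ≤⟨ halfway-wins fzero k {{ℕ.>-nonZero (m≥n⇒m/n>0 {n′} {2} (s≤s (s≤s z≤n)))}} (half-cases n′) fzero ⟩
    40 * winCount {n′} fzero k                             ≤⟨ ℕₚ.*-monoʳ-≤ 40 (winCount≤successCount w dec k) ⟩
    40 * successCount w fzero k                           ≤⟨ ℕₚ.*-monoʳ-≤ 40 (optCutoff-max w fzero k (ℕₚ.<⇒≤ (m/n<m n′ 2 (s≤s (s≤s z≤n))))) ⟩
    40 * successCount w fzero (optCutoff w fzero)         ∎
    where
    open ℕₚ.≤-Reasoning
    n′ = suc (suc m)
    k = n′ / 2

  -- Each of the at most 11 top weights is bounded by `w fzero`, which is collected in at least
  -- 11/40 of all bijections; otherwise the value is nonnegative.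
  classical-bound : ∀ n r (w : Fin n → ℚ) → (0≤w : ∀ i → 0ℚ ℚ.≤ w i) (dec : StrictlyDecreasing w) → r ≤ n → r < 12 →
    ι (length (allPerms n)) ℚ.* topSum w r ℚ.≤ ι 40 ℚ.* ∑ℚ (allPerms n) (classicalSecretary w)
  classical-bound zero r w 0≤w dec r≤n r<12 = ℚₚ.≤-reflexive (trans (ℚₚ.*-zeroʳ (ι 1)) (sym (ℚₚ.*-zeroʳ (ι 40))))
  classical-bound (suc m) r w 0≤w dec r≤n r<12 = begin
    ι N ℚ.* topSum w r              ≤⟨ ι-*-monoʳ N (top-max w dec r r≤n fzero refl) ⟩
    ι N ℚ.* (ι r ℚ.* w₀)                 ≡⟨ ℚₚ.*-assoc (ι N) (ι r) w₀ ⟨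
    ι N ℚ.* ι r ℚ.* w₀                   ≡⟨ cong (ℚ._* w₀) (ι-* N r) ⟨
    ι (N * r) ℚ.* w₀                     ≤⟨ ι-*-monoˡ (0≤w fzero) (ℕₚ.≤-trans (ℕₚ.≤-reflexive (ℕₚ.*-comm N r)) (ℕₚ.≤-trans (ℕₚ.*-monoˡ-≤ N (ℕ.s≤s⁻¹ r<12)) (best-successCount w dec))) ⟩
    ι (40 * successes) ℚ.* w₀            ≡⟨ cong (ℚ._* w₀) (ι-* 40 successes) ⟩
    ι 40 ℚ.* ι successes ℚ.* w₀          ≡⟨ ℚₚ.*-assoc (ι 40) (ι successes) w₀ ⟩
    ι 40 ℚ.* (ι successes ℚ.* w₀)        ≤⟨ ι-*-monoʳ 40 value ⟩
    ι 40 ℚ.* ∑ℚ (allPerms (suc m)) (classicalSecretary w) ∎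
    where
    open ℚₚ.≤-Reasoning
    N = length (allPerms (suc m))
    w₀ = w fzero
    k = optCutoff w fzero
    successes = successCount w fzero k
    pick : Vec (Fin (suc m)) (suc m) → ℚ
    pick π = secretaryCutoff k (weightsInOrder w π)
    pick-nonNeg : ∀ π → 0ℚ ℚ.≤ pick π
    pick-nonNeg π = firstBeating-nonNeg (maxM (take k (weightsInOrder w π))) (drop k (weightsInOrder w π))
      (λ x∈ → let (e , _ , eq) = ∈-map⁻ (λ e → w (lookup π e)) {xs = allFin (suc m)} (drop-⊆ k (weightsInOrder w π) x∈) in subst (0ℚ ℚ.≤_) (sym eq) (0≤w (lookup π e)))
    term : ∀ π (d : Dec (pick π ≡ w₀)) → ι (𝟙 d) ℚ.* w₀ ℚ.≤ pick π
    term π (yes eq) = ℚₚ.≤-reflexive (trans (ι-1-* w₀) (sym eq))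
    term π (no _)   = ℚₚ.≤-trans (ℚₚ.≤-reflexive (ι-0-* w₀)) (pick-nonNeg π)
    value : ι successes ℚ.* w₀ ℚ.≤ ∑ℚ (allPerms (suc m)) (classicalSecretary w)
    value = begin
      ι successes ℚ.* w₀ ≡⟨ cong (λ x → ι x ℚ.* w₀) (length-filter (λ π → pick π ℚ.≟ w₀) (allPerms (suc m))) ⟩
      ι (∑ (allPerms (suc m)) (λ π → 𝟙 (pick π ℚ.≟ w₀))) ℚ.* w₀ ≡⟨ ∑ℚ-ι* (allPerms (suc m)) (λ π → 𝟙 (pick π ℚ.≟ w₀)) w₀ ⟨
      ∑ℚ (allPerms (suc m)) (λ π → ι (𝟙 (pick π ℚ.≟ w₀)) ℚ.* w₀) ≤⟨ ∑ℚ-mono (allPerms (suc m)) (λ π _ → term π (pick π ℚ.≟ w₀)) ⟩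
      ∑ℚ (allPerms (suc m)) pick ∎

  module _ (M : Matroid n) (ud : UniformlyDense M) (w : Fin n → ℚ) (0≤w : ∀ i → 0ℚ ℚ.≤ w i) (dec : StrictlyDecreasing w) (12≤r : 12 ≤ rk M) where

    private
      r = rk M
      q = r / 4
      h = n / 2
      N = length (allPerms n)
      d = r ∸ 2 * (2 + q)
      total = ∑ℚ (allPerms n) (thresholdGreedy M w)

    12≤n : 12 ≤ n
    12≤n = ℕₚ.≤-trans 12≤r (rk≤n M)

    goodCount-bound : ∀ i → d * N ≤ 2 * r * goodCount M h q i
    goodCount-bound i = ℕₚ.≤-trans (ℕₚ.≤-reflexive (ℕₚ.*-distribʳ-∸ N r (2 * (2 + q))))
      (ℕₚ.m≤n+o⇒m∸n≤o (r * N) (2 * (2 + q) * N) (ℕₚ.≤-trans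
        -- The reference position is `fromℕ< h<n`, the first one of `B`.
        (good-bound M h q ud (ℕₚ.≤-trans (s≤s z≤n) 12≤r) (proj₁ (halves (half-cases n))) (proj₂ (halves (half-cases n))) (fromℕ< h<n) (ℕₚ.≤-reflexive (sym (Finₚ.toℕ-fromℕ< h<n))) i)
        (ℕₚ.≤-reflexive (ℕₚ.+-comm (2 * r * goodCount M h q i) _))))
      where
      h<n : h < n
      h<n = m/n<m n 2 {{ℕ.>-nonZero (ℕₚ.≤-trans (s≤s z≤n) 12≤n)}} (s≤s (s≤s z≤n))
      halves : n ≡ h + h ⊎ n ≡ suc (h + h) → h + h ≤ n × n ≤ suc (h + h)
      halves (inj₁ eq) = ℕₚ.≤-reflexive (sym eq) , ℕₚ.≤-trans (ℕₚ.≤-reflexive eq) (ℕₚ.n≤1+n _)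
      halves (inj₂ eq) = ℕₚ.≤-trans (ℕₚ.n≤1+n _) (ℕₚ.≤-reflexive (sym eq)) , ℕₚ.≤-reflexive eq

    top-total : ι (d * N) ℚ.* topSum w (suc q) ℚ.≤ ι (2 * r) ℚ.* total
    top-total = begin
      ι (d * N) ℚ.* topSum w (suc q)
        ≡⟨ ∑ℚ-*ˡ (allFin n) (ι (d * N)) _ ⟨
      ∑ℚ (allFin n) (λ i → ι (d * N) ℚ.* (ι (𝟙 (toℕ i <? suc q)) ℚ.* w i))
        ≤⟨ ∑ℚ-mono (allFin n) (λ i _ → term i) ⟩
      ∑ℚ (allFin n) (λ i → ι (2 * r) ℚ.* (ι (𝟙 (toℕ i <? suc q) * goodCount M h q i) ℚ.* w i))
        ≡⟨ ∑ℚ-*ˡ (allFin n) (ι (2 * r)) _ ⟩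
      ι (2 * r) ℚ.* ∑ℚ (allFin n) (λ i → ι (𝟙 (toℕ i <? suc q) * goodCount M h q i) ℚ.* w i)
        ≤⟨ ι-*-monoʳ (2 * r) (expected-gain M w 0≤w dec) ⟩
      ι (2 * r) ℚ.* total ∎
      where
      open ℚₚ.≤-Reasoning
      lem : ∀ a b c → a * (b * c) ≡ a * c * b
      lem = solve-∀
      term : ∀ i → ι (d * N) ℚ.* (ι (𝟙 (toℕ i <? suc q)) ℚ.* w i) ℚ.≤ ι (2 * r) ℚ.* (ι (𝟙 (toℕ i <? suc q) * goodCount M h q i) ℚ.* w i)
      term i = begin
        ι (d * N) ℚ.* (ι b ℚ.* w i)              ≡⟨ ι-assoc (d * N) b (w i) ⟩
        ι (d * N * b) ℚ.* w i                    ≤⟨ ι-*-monoˡ (0≤w i) (ℕₚ.≤-trans (ℕₚ.*-monoˡ-≤ b (goodCount-bound i)) (ℕₚ.≤-reflexive (sym (lem (2 * r) b (goodCount M h q i))))) ⟩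
        ι (2 * r * (b * goodCount M h q i)) ℚ.* w i ≡⟨ ι-assoc (2 * r) (b * goodCount M h q i) (w i) ⟨
        ι (2 * r) ℚ.* (ι (b * goodCount M h q i) ℚ.* w i) ∎
        where b = 𝟙 (toℕ i <? suc q)

    -- All is multiplied by 2r²: `top-total` needs the factor 2r and `top-ratio` a factor r, while
    -- `ratio-bound` trades r² for 20 (q + 1) d.
    greedy-bound : ι N ℚ.* topSum w r ℚ.≤ ι 40 ℚ.* total
    greedy-bound = ℚₚ.*-cancelˡ-≤-pos (ι (2 * (r * r))) {{positive}} (begin
      ι (2 * (r * r)) ℚ.* (ι N ℚ.* W)                    ≤⟨ ι-*-monoˡ (ι-*-nonNeg N W-nonNeg) (ℕₚ.*-monoʳ-≤ 2 (ratio-bound r 12≤r)) ⟩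
      ι (2 * (20 * suc q * d)) ℚ.* (ι N ℚ.* W)           ≡⟨ trans (ι-assoc (2 * (20 * suc q * d)) N W) (cong (λ x → ι x ℚ.* W) (lem₁ q d N)) ⟩
      ι (40 * (d * N) * suc q) ℚ.* W                     ≡⟨ ι-assoc (40 * (d * N)) (suc q) W ⟨
      ι (40 * (d * N)) ℚ.* (ι (suc q) ℚ.* W)             ≤⟨ ι-*-monoʳ (40 * (d * N)) (top-ratio w dec q r q<r (rk≤n M)) ⟩
      ι (40 * (d * N)) ℚ.* (ι r ℚ.* X)                   ≡⟨ trans (ι-assoc (40 * (d * N)) r X) (cong (λ x → ι x ℚ.* X) (lem₂ d N r)) ⟩
      ι (40 * r * (d * N)) ℚ.* X                         ≡⟨ ι-assoc (40 * r) (d * N) X ⟨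
      ι (40 * r) ℚ.* (ι (d * N) ℚ.* X)                   ≤⟨ ι-*-monoʳ (40 * r) top-total ⟩
      ι (40 * r) ℚ.* (ι (2 * r) ℚ.* total)               ≡⟨ trans (ι-assoc (40 * r) (2 * r) total) (cong (λ x → ι x ℚ.* total) (lem₃ r)) ⟩
      ι (2 * (r * r) * 40) ℚ.* total                     ≡⟨ ι-assoc (2 * (r * r)) 40 total ⟨
      ι (2 * (r * r)) ℚ.* (ι 40 ℚ.* total)               ∎)
      where
      open ℚₚ.≤-Reasoning
      W = topSum w r
      X = topSum w (suc q)
      lem₁ : ∀ q d N → 2 * (20 * suc q * d) * N ≡ 40 * (d * N) * suc q
      lem₁ = solve-∀
      lem₂ : ∀ d N r → 40 * (d * N) * r ≡ 40 * r * (d * N)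
      lem₂ = solve-∀
      lem₃ : ∀ r → 40 * r * (2 * r) ≡ 2 * (r * r) * 40
      lem₃ = solve-∀
      r>0 : 0 < r
      r>0 = ℕₚ.≤-trans (s≤s z≤n) 12≤r
      q<r : q < r
      q<r = m/n<m r 4 {{ℕ.>-nonZero r>0}} (s≤s (s≤s z≤n))
      W-nonNeg : 0ℚ ℚ.≤ W
      W-nonNeg = ℚₚ.≤-trans (ℚₚ.≤-reflexive (sym (∑ℚ-zero (allFin n)))) (∑ℚ-mono (allFin n) (λ i _ → ι-*-nonNeg (𝟙 (toℕ i <? r)) (0≤w i)))
      positive : ℚ.Positive (ι (2 * (r * r)))
      positive = ℚ.positive (ℚₚ.<-≤-trans (subst (0ℚ ℚ.<_) (sym (ι-def 1)) (ℚₚ.positive⁻¹ 1ℚ))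
        (ι-mono {1} (ℕₚ.≤-trans (ℕₚ.*-mono-≤ r>0 r>0) (ℕₚ.m≤n*m (r * r) 2))))

  algValue-bound : ∀ (M : Matroid n) → UniformlyDense M → (w : Fin n → ℚ) → (∀ i → 0ℚ ℚ.≤ w i) → StrictlyDecreasing w →
    ι (length (allPerms n)) ℚ.* topSum w (rk M) ℚ.≤ ι 40 ℚ.* ∑ℚ (allPerms n) (algValue M w)
  algValue-bound {n} M ud w 0≤w dec = cases (rk M <? 12)
    where
    -- Abstracting the decision lets the conditional inside the sum over all bijections reduce at
    -- once.
    cases : (d : Dec (rk M < 12)) → ι (length (allPerms n)) ℚ.* topSum w (rk M) ℚ.≤
            ι 40 ℚ.* ∑ℚ (allPerms n) (λ π → if ⌊ d ⌋ then classicalSecretary w π else thresholdGreedy M w π)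
    cases (yes r<12) = classical-bound n (rk M) w 0≤w dec (rk≤n M) r<12
    cases (no r≮12)  = greedy-bound M ud w 0≤w dec (ℕₚ.≮⇒≥ r≮12)

open Lemmas using (ι-def; sumℚ-filter; algValue-bound)
open import Data.Nat using (ℕ)
open import Data.Integer as ℤ using ()
open import Data.Fin using (Fin; toℕ)
open import Data.Nat using () renaming (_<_ to _<ℕ_)
open import Data.List using (length; map; filter; allFin)
open import Data.Rational using (ℚ; 0ℚ; _≤_; _<_; _*_) renaming (_/_ to _÷_)
open import Data.Nat.Properties using (_<?_)
open import Relation.Nullary.Decidable using (⌊_⌋)
open import Relation.Binary.PropositionalEquality using (sym; cong; cong₂; subst₂)

theorem1 : ∀ (n : ℕ) (M : Matroid n) → UniformlyDense M →
    (w : Fin n → ℚ) →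
    (∀ i → 0ℚ ≤ w i) →
    (∀ i j → toℕ i <ℕ toℕ j → w j < w i) →
    ((ℤ.+ length (allPerms n) ÷ 1) * sumℚ (map w (filter (λ i → toℕ i <? rk M) (allFin n))))
    ≤ ((ℤ.+ 40 ÷ 1) * sumℚ (map (algValue M w) (allPerms n)))
theorem1 n M ud w 0≤w dec = subst₂ _≤_
  (cong₂ _*_ (ι-def (length (allPerms n))) (sym (sumℚ-filter (λ i → toℕ i <? rk M) w (allFin n))))
  (cong (_* sumℚ (map (algValue M w) (allPerms n))) (ι-def 40))
  (algValue-bound M ud w 0≤w dec)
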